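{- Let $\mathcal{K}$ be a class of geometric objects in the plane such that the Maximum Independent Set problem is W[1]-complete on the intersection graphs of finite collections of objects from $\mathcal{K}$. Then the Maximum Bipartite Subgraph problem is W[1]-complete on the intersection graphs of finite collections of objects from $\mathcal{K}$.
   Context: The intersection graph of a finite collection of geometric objects has one vertex per object, two vertices being adjacent if and only if the corresponding objects intersect. Collections may contain the same object more than once in the same position (such copies are distinct, mutually adjacent vertices). Both problems are parameterized by the solution size $k$: the Maximum Independent Set problem asks whether the intersection graph has an independent set of size at least $k$; the Maximum Bipartite Subgraph problem asks whether there is a subcollection of at least $k$ objects whose intersection graph is bipartite. -}

module Defs where

open import Level using (Level; _⊔_; 0ℓ) renaming (suc to lsuc)
open import Data.Bool.Base as Bool using (Bool; true; false; if_then_else_)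
open import Data.Fin.Base using (Fin; toℕ)
open import Data.Fin.Subset using (Subset; _∈_; ∣_∣)
open import Data.Integer.Base using (+_)
open import Data.List.Base as List using (List; []; _∷_; _++_; [_]; length; concat; concatMap; replicate; drop)
open import Data.Nat.Base as ℕ using (ℕ; zero; suc; _+_; _*_; _^_; _≤_)
open import Data.Nat.Properties using (_≟_)
open import Data.Product.Base using (Σ; ∃; ∃-syntax; ∃₂; _×_; _,_; proj₁)
open import Data.Product.Relation.Binary.Pointwise.NonDependent using (Pointwise)
open import Data.Rational.Base as ℚ using (ℚ; _/_)
open import Data.Vec.Base as Vec using (Vec; lookup)
open import Function.Bundles using (_⇔_)
open import Relation.Binary.Core using (Rel)
open import Relation.Binary.Definitions using (_Respects_)
open import Relation.Binary.PropositionalEquality.Core using (_≡_; _≢_)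
open import Relation.Nullary.Decidable.Core using (does)
open import Relation.Nullary.Negation.Core using (¬_)
open import Relation.Unary using (Pred; Satisfiable; _≬_)

private
  variable
    a b ℓ : Level
    n m : ℕ

-- Real numbers as regular Cauchy sequences of rationals (Bishop), compared by
-- the setoid equality _≈ℝ_.

record ℝ : Set where
  field
    seq     : ℕ → ℚ
    regular : ∀ i j → ℚ.∣ seq i ℚ.- seq j ∣ ℚ.≤ (+ 1 / suc i) ℚ.+ (+ 1 / suc j)

_≈ℝ_ : Rel ℝ 0ℓ
x ≈ℝ y = ∀ i → ℚ.∣ ℝ.seq x i ℚ.- ℝ.seq y i ∣ ℚ.≤ + 2 / suc i

Point : Set
Point = ℝ × ℝ

-- Objects are nonempty, so that two copies of one object do intersect.

record GeometricObject : Set₁ where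
  field
    region   : Pred Point 0ℓ
    respects : region Respects Pointwise _≈ℝ_ _≈ℝ_
    nonempty : Satisfiable region

open GeometricObject public using (region)

record Graph (V : Set a) : Set a where
  field
    edge        : V → V → Bool
    symmetric   : ∀ u v → edge u v ≡ edge v u
    irreflexive : ∀ v → edge v v ≡ false

  Adjacent : Rel V 0ℓ
  Adjacent u v = edge u v ≡ true

open Graph public

_⟦_⟧ : Graph (Fin n) → (S : Subset n) → Graph (∃ (_∈ S))
G ⟦ S ⟧ = record
  { edge        = λ u v → edge G (proj₁ u) (proj₁ v)
  ; symmetric   = λ u v → symmetric G (proj₁ u) (proj₁ v)
  ; irreflexive = λ v → irreflexive G (proj₁ v)
  }

Independent : Graph (Fin n) → Subset n → Set
Independent G S = ∀ {u v} → u ∈ S → v ∈ S → ¬ Adjacent G u v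

Bipartite : {V : Set} → Graph V → Set
Bipartite {V} G = Σ (V → Bool) λ side → ∀ u v → Adjacent G u v → side u ≢ side v

-- A collection is a family indexed by Fin n, so an object may be repeated.

IsIntersectionGraph : (Fin n → GeometricObject) → Graph (Fin n) → Set
IsIntersectionGraph O G =
  ∀ i j → i ≢ j → Adjacent G i j ⇔ (region (O i) ≬ region (O j))

IntersectionGraphOf : Pred GeometricObject ℓ → Graph (Fin n) → Set (lsuc 0ℓ ⊔ ℓ)
IntersectionGraphOf {n = n} 𝒦 G =
  Σ (Fin n → GeometricObject) λ O → (∀ i → 𝒦 (O i)) × IsIntersectionGraph O G

Word : Set
Word = List Bool

unary : ℕ → Word
unary n = replicate n true

-- Structured programs over finitely many registers, each holding a stack of
-- bits.  Every primitive step costs one unit and touches one symbol; two stacks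
-- make up one tape, so up to constant factors the cost is the running time of a
-- deterministic multitape Turing machine.

Store : Set
Store = ℕ → Word

_[_≔_] : Store → ℕ → Word → Store
(s [ r ≔ w ]) q = if does (q ≟ r) then w else s q

infixr 5 _⨾_

data Program : Set where
  skip   : Program
  push   : Bool → ℕ → Program
  pop    : ℕ → Program
  _⨾_    : Program → Program → Program
  branch : ℕ → (onEmpty onFalse onTrue : Program) → Program
  while  : ℕ → Program → Program

infix 4 _,_⇓[_]_

-- P , s ⇓[ t ] s′ : started in store s, P halts after t steps in store s′.
-- Neither branch nor while removes the symbol it inspects; while r runs as long
-- as register r is nonempty.

data _,_⇓[_]_ : Program → Store → ℕ → Store → Set where
  ⇓skip  : ∀ {s} → skip , s ⇓[ 1 ] s
  ⇓push  : ∀ {s c r} → push c r , s ⇓[ 1 ] s [ r ≔ c ∷ s r ]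
  ⇓pop   : ∀ {s r} → pop r , s ⇓[ 1 ] s [ r ≔ drop 1 (s r) ]
  ⇓seq   : ∀ {s s′ s″ P Q t u} → P , s ⇓[ t ] s′ → Q , s′ ⇓[ u ] s″ →
           P ⨾ Q , s ⇓[ t + u ] s″
  ⇓empty : ∀ {s s′ r P Q R t} → s r ≡ [] → P , s ⇓[ t ] s′ →
           branch r P Q R , s ⇓[ suc t ] s′
  ⇓false : ∀ {s s′ r w P Q R t} → s r ≡ false ∷ w → Q , s ⇓[ t ] s′ →
           branch r P Q R , s ⇓[ suc t ] s′
  ⇓true  : ∀ {s s′ r w P Q R t} → s r ≡ true ∷ w → R , s ⇓[ t ] s′ →
           branch r P Q R , s ⇓[ suc t ] s′
  ⇓exit  : ∀ {s r P} → s r ≡ [] → while r P , s ⇓[ 1 ] s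
  ⇓loop  : ∀ {s s′ s″ r P t u} → s r ≢ [] → P , s ⇓[ t ] s′ →
           while r P , s′ ⇓[ u ] s″ → while r P , s ⇓[ suc (t + u) ] s″

-- Input and output: the word in register 0, the parameter in unary in register 1.

load : Word → ℕ → Store
load x k 0             = x
load x k 1             = unary k
load x k (suc (suc _)) = []

Computes : Program → ℕ → Word × ℕ → Word × ℕ → Set
Computes P bound (x , k) (x′ , k′) =
  ∃₂ λ t s → P , load x k ⇓[ t ] s × t ≤ bound × s 0 ≡ x′ × s 1 ≡ unary k′

Computable : (ℕ → ℕ) → Set
Computable f = ∃[ P ] (∀ k → ∃₂ λ t x → Computes P t ([] , k) (x , f k))

-- A parameterized promise problem: inputs in neither Yes nor No are outside the
-- domain.  Disjointness need not be a field: it holds for the problems below, and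
-- any problem that reduces to a disjoint one is disjoint.

record Problem ℓ : Set (lsuc ℓ) where
  field
    Yes No : Word → ℕ → Set ℓ

open Problem public

record _≤fpt_ (A : Problem a) (B : Problem b) : Set (a ⊔ b) where
  field
    program      : Program
    f            : ℕ → ℕ
    f-computable : Computable f
    degree       : ℕ
    g            : ℕ → ℕ
    g-computable : Computable g

  Image : (Word → ℕ → Set b) → Word → ℕ → Set b
  Image T x k = ∃₂ λ x′ k′ →
    Computes program (f k * suc (length x + k) ^ degree) (x , k) (x′ , k′) ×
    k′ ≤ g k × T x′ k′

  field
    yes↦yes : ∀ x k → Yes A x k → Image (Yes B) x k
    no↦no   : ∀ x k → No A x k → Image (No B) x k

-- Circuits are directed acyclic graphs listed in topological order.  A gate
-- refers to an earlier node by its distance: zero is the node listed just before.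

data Gate (m : ℕ) : Set where
  not    : Fin m → Gate m
  and or : List (Fin m) → Gate m

infixl 5 _▹_

data Nodes (n : ℕ) : ℕ → Set where
  inputs : Nodes n n
  _▹_    : Nodes n m → Gate m → Nodes n (suc m)

record Circuit (n : ℕ) : Set where
  constructor circuit
  field
    {size} : ℕ
    nodes  : Nodes n size
    output : Fin size

evaluate : {A : Set} → (∀ {m} → Gate m → Vec A m → A) → Vec A n → Nodes n m → Vec A m
evaluate φ xs inputs   = xs
evaluate φ xs (ns ▹ γ) = let vs = evaluate φ xs ns in φ γ vs Vec.∷ vs

atOutput : {A : Set} → (∀ {m} → Gate m → Vec A m → A) → Vec A n → Circuit n → A
atOutput φ xs (circuit ns o) = lookup (evaluate φ xs ns) o

maximum : List ℕ → ℕ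
maximum = List.foldr ℕ._⊔_ 0

gateValue : Gate m → Vec Bool m → Bool
gateValue (not i)  vs = Bool.not (lookup vs i)
gateValue (and is) vs = List.all (lookup vs) is
gateValue (or is)  vs = List.any (lookup vs) is

gateDepth : Gate m → Vec ℕ m → ℕ
gateDepth (not i)  ds = suc (lookup ds i)
gateDepth (and is) ds = suc (maximum (List.map (lookup ds) is))
gateDepth (or is)  ds = suc (maximum (List.map (lookup ds) is))

-- Gates of in-degree at most two are small; weft counts the large ones.

largeness : List (Fin m) → ℕ
largeness (_ ∷ _ ∷ _ ∷ _) = 1
largeness _               = 0

gateWeft : Gate m → Vec ℕ m → ℕ
gateWeft (not i)  ws = lookup ws i
gateWeft (and is) ws = largeness is + maximum (List.map (lookup ws) is)
gateWeft (or is)  ws = largeness is + maximum (List.map (lookup ws) is)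

depth weft : Circuit n → ℕ
depth {n} = atOutput gateDepth (Vec.replicate n 0)
weft  {n} = atOutput gateWeft (Vec.replicate n 0)

-- Assignments are identified with the set of inputs they make true.

WeightedSatisfiable : Circuit n → ℕ → Set
WeightedSatisfiable {n} C k =
  Σ (Subset n) λ S → ∣ S ∣ ≡ k × atOutput gateValue S C ≡ true

encodeRef : Fin m → Word
encodeRef i = unary (toℕ i) ++ [ false ]

encodeRefs : List (Fin m) → Word
encodeRefs is = concatMap (λ i → true ∷ encodeRef i) is ++ [ false ]

encodeGate : Gate m → Word
encodeGate (not i)  = false ∷ encodeRef i
encodeGate (and is) = true ∷ false ∷ encodeRefs is
encodeGate (or is)  = true ∷ true ∷ encodeRefs is

encodeGates : Nodes n m → Word
encodeGates inputs   = []
encodeGates (ns ▹ γ) = encodeGates ns ++ true ∷ encodeGate γ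

encodeCircuit : Circuit n → Word
encodeCircuit {n} (circuit ns o) =
  unary n ++ false ∷ encodeGates ns ++ false ∷ encodeRef o

encodeGraph : Graph (Fin n) → Word
encodeGraph {n} G =
  unary n ++ false ∷ concat (List.tabulate λ i → List.tabulate λ j → edge G i j)

WeightedCircuitSat : (t d : ℕ) → Problem 0ℓ
WeightedCircuitSat t d = record
  { Yes = λ x k → Instance x λ C → WeightedSatisfiable C k
  ; No  = λ x k → Instance x λ C → ¬ WeightedSatisfiable C k
  }
  where
  Instance : Word → (∀ {n} → Circuit n → Set) → Set
  Instance x Q = ∃ λ n → Σ (Circuit n) λ C →
    x ≡ encodeCircuit C × weft C ≤ t × depth C ≤ d × Q C

_∈W[_] : Problem ℓ → ℕ → Set ℓ
A ∈W[ t ] = ∃[ d ] A ≤fpt WeightedCircuitSat t d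

W[_]-Hard : ℕ → Problem ℓ → Set (lsuc ℓ)
W[_]-Hard {ℓ} t A = (B : Problem ℓ) → B ∈W[ t ] → B ≤fpt A

W[_]-Complete : ℕ → Problem ℓ → Set (lsuc ℓ)
W[ t ]-Complete A = A ∈W[ t ] × W[ t ]-Hard A

-- The input graph is given by its adjacency matrix and promised to be the
-- intersection graph of a finite collection of objects from 𝒦.

onIntersectionGraphs : Pred GeometricObject ℓ → (∀ {n} → Graph (Fin n) → ℕ → Set) →
                       Problem (lsuc 0ℓ ⊔ ℓ)
onIntersectionGraphs {ℓ} 𝒦 Q = record
  { Yes = λ x k → Instance x λ G → Q G k
  ; No  = λ x k → Instance x λ G → ¬ Q G k
  }
  where
  Instance : Word → (∀ {n} → Graph (Fin n) → Set) → Set (lsuc 0ℓ ⊔ ℓ)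
  Instance x R = ∃ λ n → Σ (Graph (Fin n)) λ G →
    x ≡ encodeGraph G × IntersectionGraphOf 𝒦 G × R G

MaximumIndependentSet : Pred GeometricObject ℓ → Problem (lsuc 0ℓ ⊔ ℓ)
MaximumIndependentSet 𝒦 = onIntersectionGraphs 𝒦 λ {n} G k →
  Σ (Subset n) λ S → k ≤ ∣ S ∣ × Independent G S

MaximumBipartiteSubgraph : Pred GeometricObject ℓ → Problem (lsuc 0ℓ ⊔ ℓ)
MaximumBipartiteSubgraph 𝒦 = onIntersectionGraphs 𝒦 λ {n} G k →
  Σ (Subset n) λ S → k ≤ ∣ S ∣ × Bipartite (G ⟦ S ⟧)

{-# OPTIONS --safe #-}

-- The subgraph induced by S is bipartite iff S is the union of two disjoint
-- independent sets.  For hardness, replace every object by two copies of itself: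
-- an independent set of size at least k, taken with both copies, gives a bipartite
-- subgraph of size at least 2k, and of two disjoint independent sets of total size
-- at least 2k one has size at least k and meets each pair of copies at most once.
-- For membership, two disjoint independent sets of G are one independent set of
-- the product of G with an edge; independence of a vertex set is expressed by
-- the circuit ¬ ⋁ (x_i ∧ x_j) over the edges ij, which has weft 1 and depth 3.
module Submission where

open import Level using (Level; _⊔_; 0ℓ)
open import Defs
open import Data.Bool.Base as Bool using (Bool; true; false; if_then_else_; _∧_; _∨_; _xor_)
open import Data.Bool.ListAction using (any)
open import Data.Bool.Properties using (¬-not; ∧-identityʳ; ∨-zeroʳ; xor-comm; xor-same)
open import Data.Fin.Base using (Fin; toℕ; zero; suc; _↑ˡ_; _↑ʳ_; opposite)
open import Data.Fin.Patterns
import Data.Fin.Properties as Fin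
open import Data.Fin.Subset using (Subset; _∈_; _∉_; _⊆_; ∣_∣; _∪_; _∩_; ∁)
open import Data.Fin.Subset.Properties using (_∈?_; x∈∁p⇒x∉p; x∈p∩q⁻; x∈p∪q⁻)
open import Data.List.Base as List
  using (List; []; _∷_; _++_; length; drop; _ʳ++_; concat; concatMap; reverse)
open import Data.List.Membership.Propositional using () renaming (_∈_ to _∈ₗ_)
open import Data.List.Membership.Propositional.Properties using (∈-concat⁺′; ∈-tabulate⁺)
open import Data.List.Properties using (++-assoc; ++-ʳ++; length-++; length-drop; length-replicate;
  length-reverse; length-tabulate; length-ʳ++; reverse-involutive; tabulate-cong)
open import Data.List.Relation.Unary.Any using (index)
open import Data.List.Relation.Unary.Any.Properties using (lookup-index; reverse⁺)
open import Data.Nat.Base hiding (_⊔_)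
open import Data.Nat.Properties
open import Data.Product.Base
open import Data.Sum.Base using (_⊎_; inj₁; inj₂)
open import Data.Vec.Base as Vec
  using (Vec; []; _∷_; lookup; tabulate; updateAt; _[_]≔_; here; there)
open import Data.Vec.Properties using (lookup∘tabulate; lookup∘update; lookup∘update′;
  lookup∘updateAt; lookup∘updateAt′; lookup-replicate; lookup⇒[]=; []=⇒lookup;
  updateAt-commutes; updateAt-updateAt)
open import Function.Base using (_∘_; id; const)
open import Function.Bundles using (_⇔_; mk⇔; Equivalence)
open import Function.Definitions using (Injective)
open import Relation.Binary.PropositionalEquality
open import Relation.Nullary.Decidable using (Dec; yes; no; does; dec-true; dec-false)
open import Relation.Nullary.Negation using (¬_; contradiction)
open import Relation.Unary using (Pred; _≬_)

-- Duplicating objects stays inside `𝒦`, but the product of `G` with an edge need not be an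
-- intersection graph of objects from `𝒦`. Membership therefore passes through independent set on
-- arbitrary graphs, whereas hardness keeps a geometric representation. In both constructions the
-- two copies of a vertex are adjacent: in the product this keeps the two independent sets disjoint,
-- and after duplication it keeps an independent set from counting a vertex twice. Most of the
-- length comes from the machine model. A reduction is a concrete program, so each transformation of
-- graphs is carried out on stacks of bits, with its cost counted and its scratch registers kept
-- apart from those of the program it is composed with.

private variable
  a b c ℓ : Level
  A V W : Set
  m : Bool
  k N n t u : ℕ
  v v′ v″ : Vec Word N
  P Q R : Program

-- Executions

≔-same : ∀ (s : Store) r {w} → (s [ r ≔ w ]) r ≡ w
≔-same s r {w} = cong (if_then w else s r) (dec-true (r ≟ r) refl)

≔-other : ∀ (s : Store) {r q w} → q ≢ r → (s [ r ≔ w ]) q ≡ s q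
≔-other s {r} {q} {w} q≢r = cong (if_then w else s q) (dec-false (q ≟ r) q≢r)

length-≔ : ∀ (s : Store) r {w} {t} → length w ≤ length (s r) + t →
           ∀ q → length ((s [ r ≔ w ]) q) ≤ length (s q) + t
length-≔ s r {w} p q with q ≟ r
... | yes refl rewrite ≔-same s r {w} = p
... | no q≢r rewrite ≔-other s {w = w} q≢r = m≤m+n _ _

-- No primitive step lengthens a register by more than one symbol. This bounds the word handed from
-- one reduction to the next by the time spent on producing it.
length-growth : ∀ {P s t s′} → P , s ⇓[ t ] s′ → ∀ r → length (s′ r) ≤ length (s r) + t
length-growth ⇓skip r = m≤m+n _ 1
length-growth (⇓push {s} {_} {q}) r = length-≔ s q (≤-reflexive (+-comm 1 _)) r
length-growth (⇓pop {s} {q}) r = length-≔ s q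
  (≤-trans (≤-trans (≤-reflexive (length-drop 1 (s q))) (m∸n≤m _ 1)) (m≤m+n _ 1)) r
length-growth {s = s} (⇓seq {t = t} {u} p q) r = ≤-trans (length-growth q r)
  (≤-trans (+-monoˡ-≤ u (length-growth p r)) (≤-reflexive (+-assoc (length (s r)) t u)))
length-growth (⇓empty _ p) r = ≤-trans (length-growth p r) (+-monoʳ-≤ _ (n≤1+n _))
length-growth (⇓false _ p) r = ≤-trans (length-growth p r) (+-monoʳ-≤ _ (n≤1+n _))
length-growth (⇓true _ p) r = ≤-trans (length-growth p r) (+-monoʳ-≤ _ (n≤1+n _))
length-growth (⇓exit _) r = m≤m+n _ 1
length-growth {s = s} (⇓loop {t = t} {u} _ p q) r = ≤-trans (length-growth q r)
  (≤-trans (+-monoˡ-≤ u (length-growth p r))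
  (≤-trans (≤-reflexive (+-assoc (length (s r)) t u)) (+-monoʳ-≤ _ (n≤1+n _))))

-- Renaming of registers

rename : (ℕ → ℕ) → Program → Program
rename ρ skip             = skip
rename ρ (push c r)       = push c (ρ r)
rename ρ (pop r)          = pop (ρ r)
rename ρ (P ⨾ Q)          = rename ρ P ⨾ rename ρ Q
rename ρ (branch r P Q R) = branch (ρ r) (rename ρ P) (rename ρ Q) (rename ρ R)
rename ρ (while r P)      = while (ρ r) (rename ρ P)

-- The last component is the frame property: registers outside the range of ρ
-- are left alone.
Simulates : (ℕ → ℕ) → Program → Store → ℕ → Store → Set
Simulates ρ P u t s′ = ∃ λ u′ → rename ρ P , u ⇓[ t ] u′ × u′ ∘ ρ ≗ s′ ×
                       (∀ {r} → (∀ q → r ≢ ρ q) → u′ r ≡ u r)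

≔-rename : ∀ {ρ} → Injective _≡_ _≡_ ρ → ∀ {u s : Store} → u ∘ ρ ≗ s → ∀ r {w w′} → w ≡ w′ →
           (u [ ρ r ≔ w ]) ∘ ρ ≗ s [ r ≔ w′ ]
≔-rename {ρ} inj {u} {s} u≗s r {w} refl q with q ≟ r
... | yes refl = trans (≔-same u (ρ r)) (sym (≔-same s r))
... | no q≢r   = trans (≔-other u (q≢r ∘ inj)) (trans (u≗s q) (sym (≔-other s q≢r)))

-- `u` has to match `s` only on the range of `ρ`, so the renamed program may start in a store that
-- other programs have littered; its time is unchanged.
rename-run : ∀ {ρ} → Injective _≡_ _≡_ ρ → ∀ {P s t s′ u} → P , s ⇓[ t ] s′ → u ∘ ρ ≗ s →
             Simulates ρ P u t s′
rename-run inj ⇓skip eq = _ , ⇓skip , eq , λ _ → refl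
rename-run inj {u = u} (⇓push {c = c} {r}) eq =
  _ , ⇓push , ≔-rename inj {u} eq r (cong (c ∷_) (eq r)) , λ out → ≔-other u (out r)
rename-run inj {u = u} (⇓pop {r = r}) eq =
  _ , ⇓pop , ≔-rename inj {u} eq r (cong (drop 1) (eq r)) , λ out → ≔-other u (out r)
rename-run inj (⇓seq p q) eq =
  let _ , p′ , eq′ , fr = rename-run inj p eq
      _ , q′ , eq″ , fr′ = rename-run inj q eq′
  in _ , ⇓seq p′ q′ , eq″ , λ out → trans (fr′ out) (fr out)
rename-run inj (⇓empty {r = r} e p) eq =
  let _ , p′ , rest = rename-run inj p eq in _ , ⇓empty (trans (eq r) e) p′ , rest
rename-run inj (⇓false {r = r} e p) eq =
  let _ , p′ , rest = rename-run inj p eq in _ , ⇓false (trans (eq r) e) p′ , rest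
rename-run inj (⇓true {r = r} e p) eq =
  let _ , p′ , rest = rename-run inj p eq in _ , ⇓true (trans (eq r) e) p′ , rest
rename-run inj (⇓exit {r = r} e) eq = _ , ⇓exit (trans (eq r) e) , eq , λ _ → refl
rename-run inj (⇓loop {r = r} ne p q) eq =
  let _ , p′ , eq′ , fr = rename-run inj p eq
      _ , q′ , eq″ , fr′ = rename-run inj q eq′
  in _ , ⇓loop (ne ∘ trans (sym (eq r))) p′ q′ , eq″ , λ out → trans (fr′ out) (fr out)

-- Runs described on finitely many registers

Agrees : Vec Word N → Store → Set
Agrees v s = ∀ i → s (toℕ i) ≡ lookup v i

-- Registers from `N` on are still empty after `distribute`, and the renamed programs that follow it
-- rely on that.
SameAbove : ℕ → Store → Store → Set
SameAbove N s s′ = ∀ {r} → N ≤ r → s′ r ≡ s r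

-- Only the first N registers are described; the others may hold anything.
record Run {N} (P : Program) (v : Vec Word N) (t : ℕ) (v′ : Vec Word N) : Set where
  constructor mkRun
  field
    execute : ∀ {s} → Agrees v s →
              ∃₂ λ t′ s′ → P , s ⇓[ t′ ] s′ × t′ ≤ t × Agrees v′ s′ × SameAbove N s s′

open Run public

Agrees-≔ : ∀ (v : Vec Word N) s → Agrees v s → ∀ i (f : Word → Word) →
           Agrees (updateAt v i f) (s [ toℕ i ≔ f (s (toℕ i)) ])
Agrees-≔ v s ag i f j with j Fin.≟ i
... | yes refl = trans (≔-same s (toℕ i)) (trans (cong f (ag i)) (sym (lookup∘updateAt i v)))
... | no j≢i   = trans (≔-other s (j≢i ∘ Fin.toℕ-injective))
                   (trans (ag j) (sym (lookup∘updateAt′ j i j≢i v)))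

SameAbove-≔ : ∀ (s : Store) (i : Fin N) {w} → SameAbove N s (s [ toℕ i ≔ w ])
SameAbove-≔ s i N≤r =
  ≔-other s λ r≡i → <⇒≱ (Fin.toℕ<n i) (≤-trans N≤r (≤-reflexive r≡i))

run-skip : Run skip v 1 v
run-skip .execute ag = _ , _ , ⇓skip , ≤-refl , ag , λ _ → refl

run-push : ∀ {c} i → Run (push c (toℕ i)) v 1 (updateAt v i (c ∷_))
run-push {v = v} {c = c} i .execute {s} ag = _ , _ , ⇓push , ≤-refl ,
  Agrees-≔ v s ag i (c ∷_) , SameAbove-≔ s i

run-pop : ∀ i → Run (pop (toℕ i)) v 1 (updateAt v i (drop 1))
run-pop {v = v} i .execute {s} ag = _ , _ , ⇓pop , ≤-refl ,
  Agrees-≔ v s ag i (drop 1) , SameAbove-≔ s i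

infixr 5 _⨾ʳ_

_⨾ʳ_ : Run P v t v′ → Run Q v′ u v″ → Run (P ⨾ Q) v (t + u) v″
(p ⨾ʳ q) .execute ag =
  let _ , _ , p′ , t≤ , ag′ , fr = p .execute ag
      _ , _ , q′ , u≤ , ag″ , fr′ = q .execute ag′
  in _ , _ , ⇓seq p′ q′ , +-mono-≤ t≤ u≤ , ag″ , λ N≤r → trans (fr′ N≤r) (fr N≤r)

run-≤ : t ≤ u → Run P v t v′ → Run P v u v′
run-≤ t≤u p .execute ag =
  let _ , _ , p′ , t≤ , ag′ , fr = p .execute ag in _ , _ , p′ , ≤-trans t≤ t≤u , ag′ , fr

run-empty : ∀ i → lookup v i ≡ [] → Run P v t v′ → Run (branch (toℕ i) P Q R) v (suc t) v′
run-empty i e p .execute ag =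
  let _ , _ , p′ , t≤ , ag′ , fr = p .execute ag in _ , _ , ⇓empty (trans (ag i) e) p′ , s≤s t≤ , ag′ , fr

run-false : ∀ i {w} → lookup v i ≡ false ∷ w → Run Q v t v′ →
    Run (branch (toℕ i) P Q R) v (suc t) v′
run-false i e p .execute ag =
  let _ , _ , p′ , t≤ , ag′ , fr = p .execute ag in _ , _ , ⇓false (trans (ag i) e) p′ , s≤s t≤ , ag′ , fr

run-true : ∀ i {w} → lookup v i ≡ true ∷ w → Run R v t v′ → Run (branch (toℕ i) P Q R) v (suc t) v′
run-true i e p .execute ag =
  let _ , _ , p′ , t≤ , ag′ , fr = p .execute ag in _ , _ , ⇓true (trans (ag i) e) p′ , s≤s t≤ , ag′ , fr

run-exit : ∀ i → lookup v i ≡ [] → Run (while (toℕ i) P) v 1 v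
run-exit i e .execute ag = _ , _ , ⇓exit (trans (ag i) e) , ≤-refl , ag , λ _ → refl

run-loop : ∀ i {c w} → lookup v i ≡ c ∷ w → Run P v t v′ → Run (while (toℕ i) P) v′ u v″ →
           Run (while (toℕ i) P) v (suc (t + u)) v″
run-loop {v = v} i {c} {w} e p q .execute {s} ag =
  let _ , _ , p′ , t≤ , ag′ , fr = p .execute ag
      _ , _ , q′ , u≤ , ag″ , fr′ = q .execute ag′
  in _ , _ , ⇓loop nonempty′ p′ q′ , s≤s (+-mono-≤ t≤ u≤) , ag″ , λ N≤r → trans (fr′ N≤r) (fr N≤r)
  where
  nonempty′ : s (toℕ i) ≢ []
  nonempty′ e′ with trans (sym e) (trans (sym (ag i)) e′)
  ... | ()

unary-ʳ++ : ∀ m n → unary m ʳ++ unary n ≡ unary (m + n)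
unary-ʳ++ zero    n = refl
unary-ʳ++ (suc m) n = trans (unary-ʳ++ m (suc n)) (cong unary (+-suc m n))

updateAt-≔ : ∀ (v : Vec Word N) i {x} (f : Word → Word) → updateAt (v [ i ]≔ x) i f ≡ v [ i ]≔ f x
updateAt-≔ v i f = updateAt-updateAt i v

updateAt-≔-≔ : ∀ (v : Vec Word N) {i j x y} → i ≢ j → (f : Word → Word) →
               updateAt (v [ i ]≔ x [ j ]≔ y) i f ≡ v [ i ]≔ f x [ j ]≔ y
updateAt-≔-≔ v {i} {j} {y = y} i≢j f =
  trans (updateAt-commutes i j i≢j _) (cong (_[ j ]≔ y) (updateAt-≔ v i f))

run-≡ : v′ ≡ v″ → Run P v t v′ → Run P v t v″
run-≡ refl p = p

move : ℕ → ℕ → Program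
move i j = while i (branch i skip (pop i ⨾ push false j) (pop i ⨾ push true j))

-- Moving between stacks reverses, hence the `ʳ++`; the programs below build their output backwards
-- and turn it round with `move 2 0`. Overwriting `i` and `j` in an arbitrary `v` keeps the state in
-- one shape through the induction on `w`.
run-move : ∀ (i j : Fin N) → i ≢ j → ∀ w o v →
           Run (move (toℕ i) (toℕ j)) (v [ i ]≔ w [ j ]≔ o) (1 + length w * 4)
               (v [ i ]≔ [] [ j ]≔ (w ʳ++ o))
run-move i j i≢j = go
  where
  top : ∀ w o v → lookup (v [ i ]≔ w [ j ]≔ o) i ≡ w
  top w o v = trans (lookup∘update′ i≢j (v [ i ]≔ w) o) (lookup∘update i v w)

  transfer : ∀ c w o v → Run (pop (toℕ i) ⨾ push c (toℕ j)) (v [ i ]≔ (c ∷ w) [ j ]≔ o) 2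
                             (v [ i ]≔ w [ j ]≔ (c ∷ o))
  transfer c w o v = run-≡ (updateAt-≔-≔ v i≢j (drop 1)) (run-pop i) ⨾ʳ
                     run-≡ (updateAt-≔ _ j (c ∷_)) (run-push j)

  go : ∀ w o v → Run (move (toℕ i) (toℕ j)) (v [ i ]≔ w [ j ]≔ o) (1 + length w * 4)
                     (v [ i ]≔ [] [ j ]≔ (w ʳ++ o))
  go [] o v = run-exit i (top [] o v)
  go (false ∷ w) o v =
    run-loop i (top _ o v) (run-false i (top _ o v) (transfer false w o v)) (go w (false ∷ o) v)
  go (true ∷ w) o v =
    run-loop i (top _ o v) (run-true i (top _ o v) (transfer true w o v)) (go w (true ∷ o) v)

-- Computable functions

-- Operands in registers 6 and 7, result in register 1, register 2 for scratch.
Operates : (ℕ → ℕ → ℕ) → Program → Set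
Operates _∙_ P = ∀ a b x y → ∃₂ λ t v → Run P
  ([] ∷ [] ∷ [] ∷ [] ∷ x ∷ y ∷ unary a ∷ unary b ∷ []) t v × lookup v 1F ≡ unary (a ∙ b)

-- Registers 6 and 7 are `left 1` and `right 1`: each renamed program finds the parameter where it
-- expects its own register 1.
distribute : Program
distribute = while 1 (pop 1 ⨾ push true 6 ⨾ push true 7)

run-distribute : ∀ k c {m} → k + c ≡ m → Run distribute
  ([] ∷ unary k ∷ [] ∷ [] ∷ [] ∷ [] ∷ unary c ∷ unary c ∷ []) (1 + k * 4)
  ([] ∷ [] ∷ [] ∷ [] ∷ [] ∷ [] ∷ unary m ∷ unary m ∷ [])
run-distribute zero    c refl = run-exit 1F refl
run-distribute (suc k) c eq = run-loop 1F refl (run-pop 1F ⨾ʳ run-push 6F ⨾ʳ run-push 7F)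
  (run-distribute k (suc c) (trans (+-suc k c) eq))

-- The even registers from 4 on and the odd ones from 5 on: disjoint workspaces for two programs,
-- with registers 0 to 3 left to the program that combines their results.
left right : ℕ → ℕ
left  q = 4 + q * 2
right q = 5 + q * 2

left-injective : Injective _≡_ _≡_ left
left-injective {p} {q} eq = *-cancelʳ-≡ p q 2 (+-cancelˡ-≡ 4 _ _ eq)

right-injective : Injective _≡_ _≡_ right
right-injective {p} {q} eq = *-cancelʳ-≡ p q 2 (+-cancelˡ-≡ 5 _ _ eq)

even≢odd′ : ∀ p q → p * 2 ≢ suc (q * 2)
even≢odd′ (suc p) (suc q) eq = even≢odd′ p q (suc-injective (suc-injective eq))

right≢left : ∀ p q → right p ≢ left q
right≢left p q eq = even≢odd′ q p (sym (+-cancelˡ-≡ 4 _ _ eq))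

lift₂-program : Program → Program → Program → Program
lift₂-program P Q R = distribute ⨾ rename left P ⨾ rename right Q ⨾ R

Computable-lift₂ : ∀ {_∙_ P f g} → Operates _∙_ P → Computable f → Computable g →
                   Computable λ k → f k ∙ g k
Computable-lift₂ {_∙_} {R} {f} {g} op (P , P-computes) (Q , Q-computes) =
  lift₂-program P Q R , λ k →
  let t₁ , x , _ , s₁ , P-runs , _ , _ , P-out = P-computes k
      t₂ , y , _ , s₂ , Q-runs , _ , _ , Q-out = Q-computes k
      _ , u₀ , D-runs , _ , ag , same = run-distribute k 0 (+-identityʳ k) .execute (start k)
      u₁ , P-runs′ , eq₁ , fr₁ = rename-run left-injective P-runs (left-input k ag same)
      u₂ , Q-runs′ , eq₂ , fr₂ = rename-run right-injective Q-runs (right-input k ag same fr₁)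
      a = f k
      b = g k
      low = λ {r} r<4 → trans (fr₂ {r} λ q eq →
          <⇒≱ r<4 (≤-trans (m≤m+n 4 _) (≤-trans (n≤1+n _) (≤-reflexive (sym eq)))))
                              (fr₁ {r} λ q eq → <⇒≱ r<4 (≤-trans (m≤m+n 4 _)
                                  (≤-reflexive (sym eq))))
      -- Registers 4 and 5 are the two copies of register 0 and hold whatever words the computations
      -- left there; `Operates` allows any.
      t₃ , v , R-runs , out = op a b (u₂ 4) (u₂ 5)
      t , u₃ , R-runs′ , _ , ag′ , _ = R-runs .execute {s = u₂} λ where
        0F → trans (low (s≤s z≤n)) (ag 0F)
        1F → trans (low (s≤s (s≤s z≤n))) (ag 1F)
        2F → trans (low (s≤s (s≤s (s≤s z≤n)))) (ag 2F)
        3F → trans (low (s≤s (s≤s (s≤s (s≤s z≤n))))) (ag 3F)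
        4F → refl
        5F → refl
        6F → trans (fr₂ λ q eq → right≢left q 1 (sym eq)) (trans (eq₁ 1) P-out)
        7F → trans (eq₂ 1) Q-out
  in _ , u₃ 0 , _ , u₃ , ⇓seq D-runs (⇓seq P-runs′ (⇓seq Q-runs′ R-runs′)) , ≤-refl , refl ,
     trans (ag′ 1F) out
  where
  start : ∀ k → Agrees ([] ∷ unary k ∷ [] ∷ [] ∷ [] ∷ [] ∷ [] ∷ [] ∷ []) (load [] k)
  start k 0F = refl
  start k 1F = refl
  start k 2F = refl
  start k 3F = refl
  start k 4F = refl
  start k 5F = refl
  start k 6F = refl
  start k 7F = refl

  distributed : ℕ → Vec Word 8
  distributed k = [] ∷ [] ∷ [] ∷ [] ∷ [] ∷ [] ∷ unary k ∷ unary k ∷ []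

  left-input : ∀ k {u} → Agrees (distributed k) u → SameAbove 8 (load [] k) u →
               u ∘ left ≗ load [] k
  left-input k ag same 0 = ag 4F
  left-input k ag same 1 = ag 6F
  left-input k ag same (suc (suc q)) = same (m≤m+n 8 _)

  right-input : ∀ k {u u′} → Agrees (distributed k) u → SameAbove 8 (load [] k) u →
                (∀ {r} → (∀ q → r ≢ left q) → u′ r ≡ u r) → u′ ∘ right ≗ load [] k
  right-input k ag same fr 0 = trans (fr (right≢left 0)) (ag 5F)
  right-input k ag same fr 1 = trans (fr (right≢left 1)) (ag 7F)
  right-input k ag same fr (suc (suc q)) =
    trans (fr (right≢left (suc (suc q)))) (same (≤-trans (m≤m+n 8 _) (n≤1+n _)))

add-program : Program
add-program = while 6 (pop 6 ⨾ push true 1) ⨾ while 7 (pop 7 ⨾ push true 1)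

operates-+ : Operates _+_ add-program
operates-+ a b x y = _ , _ , first a 0 (+-identityʳ a) ⨾ʳ second b a (+-comm b a) , refl
  where
  first : ∀ a c {m} → a + c ≡ m → Run (while 6 (pop 6 ⨾ push true 1))
    ([] ∷ unary c ∷ [] ∷ [] ∷ x ∷ y ∷ unary a ∷ unary b ∷ []) (1 + a * 3)
    ([] ∷ unary m ∷ [] ∷ [] ∷ x ∷ y ∷ [] ∷ unary b ∷ [])
  first zero    c refl = run-exit 6F refl
  first (suc a) c eq = run-loop 6F refl (run-pop 6F ⨾ʳ run-push 1F)
    (first a (suc c) (trans (+-suc a c) eq))

  second : ∀ b c {m} → b + c ≡ m → Run (while 7 (pop 7 ⨾ push true 1))
    ([] ∷ unary c ∷ [] ∷ [] ∷ x ∷ y ∷ [] ∷ unary b ∷ []) (1 + b * 3)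
    ([] ∷ unary m ∷ [] ∷ [] ∷ x ∷ y ∷ [] ∷ [] ∷ [])
  second zero    c refl = run-exit 7F refl
  second (suc b) c eq = run-loop 7F refl (run-pop 7F ⨾ʳ run-push 1F)
    (second b (suc c) (trans (+-suc b c) eq))

Computable-+ : ∀ {f g} → Computable f → Computable g → Computable λ k → f k + g k
Computable-+ = Computable-lift₂ operates-+

-- One addition of register 7 per symbol of register 6; as adding empties register 7, a second copy
-- is collected in register 2 and put back.
multiply-program : Program
multiply-program = while 6 (pop 6 ⨾ while 7 (pop 7 ⨾ push true 1 ⨾ push true 2) ⨾
                                    while 2 (pop 2 ⨾ push true 7))

operates-* : Operates _*_ multiply-program
operates-* a b x y = _ , _ , rounds a 0 (+-identityʳ (a * b)) .proj₂ , refl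
  where
  add-copy : ∀ b {w} c d {m n} → b + c ≡ m → b + d ≡ n →
    Run (while 7 (pop 7 ⨾ push true 1 ⨾ push true 2))
    ([] ∷ unary c ∷ unary d ∷ [] ∷ x ∷ y ∷ w ∷ unary b ∷ []) (1 + b * 4)
    ([] ∷ unary m ∷ unary n ∷ [] ∷ x ∷ y ∷ w ∷ [] ∷ [])
  add-copy zero    c d refl refl = run-exit 7F refl
  add-copy (suc b) c d eq eq′ = run-loop 7F refl (run-pop 7F ⨾ʳ run-push 1F ⨾ʳ run-push 2F)
    (add-copy b (suc c) (suc d) (trans (+-suc b c) eq) (trans (+-suc b d) eq′))

  restore : ∀ b {w} c d {n} → b + d ≡ n → Run (while 2 (pop 2 ⨾ push true 7))
    ([] ∷ c ∷ unary b ∷ [] ∷ x ∷ y ∷ w ∷ unary d ∷ []) (1 + b * 3)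
    ([] ∷ c ∷ [] ∷ [] ∷ x ∷ y ∷ w ∷ unary n ∷ [])
  restore zero    c d refl = run-exit 2F refl
  restore (suc b) c d eq = run-loop 2F refl (run-pop 2F ⨾ʳ run-push 7F)
    (restore b c (suc d) (trans (+-suc b d) eq))

  rounds : ∀ a c {m} → a * b + c ≡ m → ∃ λ t → Run multiply-program
    ([] ∷ unary c ∷ [] ∷ [] ∷ x ∷ y ∷ unary a ∷ unary b ∷ []) t
    ([] ∷ unary m ∷ [] ∷ [] ∷ x ∷ y ∷ [] ∷ unary b ∷ [])
  rounds zero    c refl = _ , run-exit 6F refl
  rounds (suc a) c eq = _ , run-loop 6F refl
    (run-pop 6F ⨾ʳ add-copy b c 0 refl (+-identityʳ b) ⨾ʳ restore b _ 0 (+-identityʳ b))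
    (rounds a (b + c) (trans (shift (a * b)) eq) .proj₂)
    where
    shift : ∀ m → m + (b + c) ≡ b + m + c
    shift m = trans (sym (+-assoc m b c)) (cong (_+ c) (+-comm m b))

Computable-* : ∀ {f g} → Computable f → Computable g → Computable λ k → f k * g k
Computable-* = Computable-lift₂ operates-*

Computable-const : ∀ c → Computable λ _ → c
Computable-const c = while 1 (pop 1) ⨾ pushes c , λ k →
  let _ , u , runs , _ , ag , _ = (erase k ⨾ʳ run-pushes c 0) .execute (start k)
  in _ , u 0 , _ , u , runs , ≤-refl , refl , trans (ag 1F) (cong unary (+-identityʳ c))
  where
  pushes : ℕ → Program
  pushes zero    = skip
  pushes (suc c) = push true 1 ⨾ pushes c

  erase : ∀ k → Run (while 1 (pop 1)) ([] ∷ unary k ∷ []) (1 + k * 2) ([] ∷ [] ∷ [])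
  erase zero    = run-exit 1F refl
  erase (suc k) = run-loop 1F refl (run-pop 1F) (erase k)

  run-pushes : ∀ c d → Run (pushes c) ([] ∷ unary d ∷ []) (c + 1) ([] ∷ unary (c + d) ∷ [])
  run-pushes zero    d = run-skip
  run-pushes (suc c) d = run-≡ (cong (λ n → [] ∷ unary n ∷ []) (+-suc c d))
    (run-push 1F ⨾ʳ run-pushes c (suc d))

  start : ∀ k → Agrees ([] ∷ unary k ∷ []) (load [] k)
  start k 0F = refl
  start k 1F = refl

Computable-^ : ∀ {f} → Computable f → ∀ e → Computable λ k → f k ^ e
Computable-^ f zero    = Computable-const 1
Computable-^ f (suc e) = Computable-* f (Computable-^ f e)

-- Composition of reductions

-- With a second reduction of this kind, the bounds of a composite involve `f` and `g` of the first
-- one at `k` alone. With a general second reduction, its own `f` would be evaluated at a parameter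
-- known only to be at most `g k`, which calls for monotonicity.
record _≤poly_ (A : Problem a) (B : Problem b) : Set (a ⊔ b) where
  field
    program : Program
    scale degree factor : ℕ

  PolyImage : (Word → ℕ → Set b) → Word → ℕ → Set b
  PolyImage T x k = ∃₂ λ x′ k′ →
    Computes program (scale * suc (length x + k) ^ degree) (x , k) (x′ , k′) ×
    k′ ≤ factor * k × T x′ k′

  field
    yes↦yes : ∀ x k → Yes A x k → PolyImage (Yes B) x k
    no↦no   : ∀ x k → No A x k → PolyImage (No B) x k

-- Composing with it turns a `_≤poly_` reduction into a `_≤fpt_` one. `skip` costs one step, hence
-- the constant time bound 1.
≤fpt-refl : {A : Problem a} → A ≤fpt A
≤fpt-refl = record
  { program = skip
  ; f = const 1
  ; f-computable = Computable-const 1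
  ; degree = 0
  ; g = id
  ; g-computable = skip , λ k → 1 , [] , 1 , _ , ⇓skip , ≤-refl , refl , refl
  ; yes↦yes = λ x k x∈ → x , k , (1 , _ , ⇓skip , ≤-refl , refl , refl) , ≤-refl , x∈
  ; no↦no = λ x k x∈ → x , k , (1 , _ , ⇓skip , ≤-refl , refl , refl) , ≤-refl , x∈
  }

-- Both programs keep registers 0 and 1; their scratch registers are made disjoint.
firstRegister secondRegister : ℕ → ℕ
firstRegister  (suc (suc r)) = 2 + r * 2
firstRegister  r             = r
secondRegister (suc (suc r)) = 3 + r * 2
secondRegister r             = r

first-injective : Injective _≡_ _≡_ firstRegister
first-injective {0} {0} eq = refl
first-injective {1} {1} eq = refl
first-injective {suc (suc p)} {suc (suc q)} eq =
  cong (2 +_) (*-cancelʳ-≡ p q 2 (+-cancelˡ-≡ 2 _ _ eq))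
first-injective {0} {1} ()
first-injective {0} {suc (suc q)} ()
first-injective {1} {0} ()
first-injective {1} {suc (suc q)} ()
first-injective {suc (suc p)} {0} ()
first-injective {suc (suc p)} {1} ()

second-injective : Injective _≡_ _≡_ secondRegister
second-injective {0} {0} eq = refl
second-injective {1} {1} eq = refl
second-injective {suc (suc p)} {suc (suc q)} eq =
  cong (2 +_) (*-cancelʳ-≡ p q 2 (+-cancelˡ-≡ 3 _ _ eq))
second-injective {0} {1} ()
second-injective {0} {suc (suc q)} ()
second-injective {1} {0} ()
second-injective {1} {suc (suc q)} ()
second-injective {suc (suc p)} {0} ()
second-injective {suc (suc p)} {1} ()

second-scratch : ∀ r q → secondRegister (suc (suc r)) ≢ firstRegister q
second-scratch r (suc (suc q)) eq = even≢odd′ q r (sym (suc-injective (suc-injective eq)))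

load-first : ∀ x k → load x k ∘ firstRegister ≗ load x k
load-first x k 0             = refl
load-first x k 1             = refl
load-first x k (suc (suc r)) = refl

-- The first program leaves debris only in its own scratch registers. Those of the second lie
-- outside the range of `firstRegister`, so they are still empty and the second program sees
-- `load y j` on its registers.
Computes-⨾ : ∀ {P Q t u x y z i j k} → Computes P t (x , i) (y , j) → Computes Q u (y , j) (z , k) →
             Computes (rename firstRegister P ⨾ rename secondRegister Q) (t + u) (x , i) (z , k)
Computes-⨾ {y = y} {i = i} {j} (_ , s , p , t≤ , y-out , j-out) (_ , _ , q , u≤ , z-out , k-out) =
  let _ , p′ , eq , fr = rename-run first-injective p (load-first _ i)
      _ , q′ , eq′ , _ = rename-run second-injective q λ where
        0             → trans (eq 0) y-out
        1             → trans (eq 1) j-out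
        (suc (suc r)) → fr (second-scratch r)
  in _ , _ , ⇓seq p′ q′ , +-mono-≤ t≤ u≤ , trans (eq′ 0) z-out , trans (eq′ 1) k-out

output-length : ∀ {P t x y i j} → Computes P t (x , i) (y , j) → length y ≤ length x + t
output-length (_ , s , p , t≤ , y-out , _) =
  ≤-trans (≤-reflexive (cong length (sym y-out)))
          (≤-trans (length-growth p 0) (+-monoʳ-≤ _ t≤))

n≤n*m : ∀ n m → 1 ≤ m → n ≤ n * m
n≤n*m n m 1≤m = ≤-trans (≤-reflexive (sym (*-identityʳ n))) (*-monoʳ-≤ n 1≤m)

^-distribʳ-* : ∀ e m n → (m * n) ^ e ≡ m ^ e * n ^ e
^-distribʳ-* zero    m n = refl
^-distribʳ-* (suc e) m n = trans (cong (m * n *_) (^-distribʳ-* e m n))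
                                 ([m*n]*[o*p]≡[m*o]*[n*p] m n (m ^ e) (n ^ e))

module _ where
  open ≤-Reasoning

  -- One quantity, `B = (1 + f + g) * L ^ suc d`, dominates both the first running time and the
  -- second input together with its parameter. The exponent `suc degree` in place of `degree` keeps
  -- `B` itself below the power even when `degree` is zero, so both summands become multiples of
  -- `B ^ suc degree`.
  composite-time : ∀ scale degree d f g {ℓ k ℓ′ k′} →
    ℓ′ ≤ ℓ + f * suc (ℓ + k) ^ d → k′ ≤ g →
    f * suc (ℓ + k) ^ d + scale * suc (ℓ′ + k′) ^ degree ≤
    (suc scale * (1 + f + g) ^ suc degree) * suc (ℓ + k) ^ (suc d * suc degree)
  composite-time scale degree d f g {ℓ} {k} {ℓ′} {k′} ℓ′≤ k′≤ = begin
    f * L ^ d + scale * suc (ℓ′ + k′) ^ degree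
      ≤⟨ +-mono-≤ (≤-trans f≤ (B≤ (suc degree) (s≤s z≤n)))
          (*-monoʳ-≤ scale (≤-trans (^-monoˡ-≤ degree input≤) (^-monoʳ-≤ B (n≤1+n degree)))) ⟩
    B ^ suc degree + scale * B ^ suc degree
      ≡⟨⟩
    suc scale * B ^ suc degree
      ≡⟨ cong (suc scale *_) (^-distribʳ-* (suc degree) (1 + f + g) (L ^ suc d)) ⟩
    suc scale * ((1 + f + g) ^ suc degree * (L ^ suc d) ^ suc degree)
      ≡⟨ *-assoc (suc scale) ((1 + f + g) ^ suc degree) _ ⟨
    (suc scale * (1 + f + g) ^ suc degree) * (L ^ suc d) ^ suc degree
      ≡⟨ cong ((suc scale * (1 + f + g) ^ suc degree) *_) (^-*-assoc L (suc d) (suc degree)) ⟩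
    (suc scale * (1 + f + g) ^ suc degree) * L ^ (suc d * suc degree) ∎
    where
    L = suc (ℓ + k)
    B = (1 + f + g) * L ^ suc d

    instance
      B≢0 : NonZero B
      B≢0 = m*n≢0 (1 + f + g) (L ^ suc d) ⦃ _ ⦄ ⦃ m^n≢0 L (suc d) ⦄

    B≤ : ∀ e → 1 ≤ e → B ≤ B ^ e
    B≤ e 1≤e = ≤-trans (≤-reflexive (sym (^-identityʳ B))) (^-monoʳ-≤ B 1≤e)

    f≤ : f * L ^ d ≤ B
    f≤ = *-mono-≤ (≤-trans (n≤1+n f) (m≤m+n (suc f) g)) (^-monoʳ-≤ L (n≤1+n d))

    input≤ : suc (ℓ′ + k′) ≤ B
    input≤ = begin
      suc (ℓ′ + k′)
        ≤⟨ s≤s (+-mono-≤ ℓ′≤ k′≤) ⟩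
      suc (ℓ + f * L ^ d) + g
        ≤⟨ +-mono-≤ (+-mono-≤ (≤-trans (s≤s (m≤m+n ℓ k))
            (≤-trans (≤-reflexive (sym (^-identityʳ L))) (^-monoʳ-≤ L {1} {suc d} (s≤s z≤n))))
                             (*-monoʳ-≤ f (^-monoʳ-≤ L (n≤1+n d)))) (n≤n*m g _ (m^n>0 L (suc d))) ⟩
      L ^ suc d + f * L ^ suc d + g * L ^ suc d
        ≡⟨ *-distribʳ-+ (L ^ suc d) (suc f) g ⟨
      (1 + f + g) * L ^ suc d ∎

≤fpt-≤poly-trans : {A : Problem a} {B : Problem b} {C : Problem c} → A ≤fpt B → B ≤poly C → A ≤fpt C
≤fpt-≤poly-trans {A = A} {B} {C} R S = record
  { program = rename firstRegister R.program ⨾ rename secondRegister S.program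
  ; f = λ k → suc S.scale * (1 + R.f k + R.g k) ^ suc S.degree
  ; f-computable = Computable-* (Computable-const (suc S.scale))
      (Computable-^ (Computable-+ (Computable-+
          (Computable-const 1) R.f-computable) R.g-computable) (suc S.degree))
  ; degree = suc R.degree * suc S.degree
  ; g = λ k → S.factor * R.g k
  ; g-computable = Computable-* (Computable-const S.factor) R.g-computable
  ; yes↦yes = λ x k x∈ → chain {Tb = Yes B} {Yes C} S.yes↦yes (R.yes↦yes x k x∈)
  ; no↦no = λ x k x∈ → chain {Tb = No B} {No C} S.no↦no (R.no↦no x k x∈)
  }
  where
  module R = _≤fpt_ R
  module S = _≤poly_ S

  chain : ∀ {x k} {Tb : Word → ℕ → Set _} {Tc : Word → ℕ → Set _} →
          (∀ y j → Tb y j → S.PolyImage Tc y j) → R.Image Tb x k →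
    ∃₂ λ x′ k′ →
    Computes (rename firstRegister R.program ⨾ rename secondRegister S.program)
      (suc S.scale * (1 + R.f k + R.g k) ^ suc S.degree * suc (length x + k) ^
          (suc R.degree * suc S.degree))
      (x , k) (x′ , k′) ×
    k′ ≤ S.factor * R.g k × Tc x′ k′
  chain {x} {k} step (y , j , p , j≤ , y∈T) with step y j y∈T
  ... | z , i , q , i≤ , z∈T with Computes-⨾ p q
  ... | t , s , pq , t≤ , outs =
    z , i , (t , s , pq , ≤-trans t≤
        (composite-time S.scale S.degree R.degree (R.f k) (R.g k) {length x} {k} {length y}
            (output-length p) j≤) , outs) ,
    ≤-trans i≤ (*-monoʳ-≤ S.factor j≤) , z∈T

-- Prisms over a graph

-- The two copies of `i` get the neighbouring numbers `2i` and `2i + 1`, so the doubled matrix comes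
-- out row by row in a single pass over the original one.
half : ∀ n → Fin (n * 2) → Fin n × Bool
half (suc n) zero          = zero , false
half (suc n) (suc zero)    = zero , true
half (suc n) (suc (suc x)) = map₁ suc (half n x)

twin : Fin n × Bool → Fin (n * 2)
twin (zero  , false) = zero
twin (zero  , true)  = suc zero
twin (suc i , a)     = suc (suc (twin (i , a)))

half-twin : ∀ (p : Fin n × Bool) → half n (twin p) ≡ p
half-twin (zero  , false) = refl
half-twin (zero  , true)  = refl
half-twin (suc i , a)     = cong (map₁ suc) (half-twin (i , a))

twin-half : ∀ n x → twin (half n x) ≡ x
twin-half (suc n) zero          = refl
twin-half (suc n) (suc zero)    = refl
twin-half (suc n) (suc (suc x)) = cong (λ y → suc (suc y)) (twin-half n x)

pullback : (V → W) → Graph W → Graph V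
pullback φ G = record
  { edge        = λ u v → edge G (φ u) (φ v)
  ; symmetric   = λ u v → symmetric G (φ u) (φ v)
  ; irreflexive = λ v → irreflexive G (φ v)
  }

-- true: the intersection graph after duplicating every object;
-- false: the Cartesian product of G with an edge.
prism : Bool → Graph (Fin n) → Graph (Fin n × Bool)
prism m G = record
  { edge        = λ (i , a) (j , b) → if a xor b then cross i j else edge G i j
  ; symmetric   = λ (i , a) (j , b) →
      cong₂ (λ c (e , e′) → if c then e else e′) (xor-comm a b)
            (cong₂ _,_ (cong₂ (λ d e → d ∨ (m ∧ e)) (≟-comm i j) (symmetric G i j))
                (symmetric G i j))
  ; irreflexive = λ (i , a) → trans (cong (if_then cross i i else edge G i i) (xor-same a))
      (irreflexive G i)
  }
  where
  cross = λ i j → does (i Fin.≟ j) ∨ (m ∧ edge G i j)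

  ≟-comm : ∀ {n} (i j : Fin n) → does (i Fin.≟ j) ≡ does (j Fin.≟ i)
  ≟-comm zero    zero    = refl
  ≟-comm zero    (suc j) = refl
  ≟-comm (suc i) zero    = refl
  ≟-comm (suc i) (suc j) = ≟-comm i j

doubled : Bool → Graph (Fin n) → Graph (Fin (n * 2))
doubled {n} m G = pullback (half n) (prism m G)

prism-rung : ∀ (G : Graph (Fin n)) i → Adjacent (prism m G) (i , false) (i , true)
prism-rung {m = m} G i = cong (_∨ (m ∧ edge G i i)) (dec-true (i Fin.≟ i) refl)

prism-twins : ∀ (G : Graph (Fin n)) {i j} a b → Adjacent G i j →
    Adjacent (prism true G) (i , a) (j , b)
prism-twins G {i} {j} false true  e = trans (cong (does (i Fin.≟ j) ∨_) e) (∨-zeroʳ _)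
prism-twins G {i} {j} true  false e = trans (cong (does (i Fin.≟ j) ∨_) e) (∨-zeroʳ _)
prism-twins G false false e = e
prism-twins G true  true  e = e

product-adjacent : ∀ (G : Graph (Fin n)) {i j} {a b} → Adjacent (prism false G) (i , a) (j , b) →
                   (a ≡ b × Adjacent G i j) ⊎ (a ≢ b × i ≡ j)
product-adjacent G {a = false} {false} e = inj₁ (refl , e)
product-adjacent G {a = true}  {true}  e = inj₁ (refl , e)
product-adjacent G {i} {j} {false} {true} e with i Fin.≟ j
... | yes i≡j = inj₂ ((λ ()) , i≡j)
product-adjacent G {i} {j} {true} {false} e with i Fin.≟ j
... | yes i≡j = inj₂ ((λ ()) , i≡j)

-- Vertex sets of a doubled graph

merge : Subset n → Subset n → Subset (n * 2)
merge []      []      = []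
merge (a ∷ A) (b ∷ B) = a ∷ b ∷ merge A B

∣merge∣ : ∀ (A B : Subset n) → ∣ merge A B ∣ ≡ ∣ A ∣ + ∣ B ∣
∣merge∣ []          []          = refl
∣merge∣ (false ∷ A) (false ∷ B) = ∣merge∣ A B
∣merge∣ (false ∷ A) (true ∷ B)  = trans (cong suc (∣merge∣ A B)) (sym (+-suc ∣ A ∣ ∣ B ∣))
∣merge∣ (true ∷ A)  (false ∷ B) = cong suc (∣merge∣ A B)
∣merge∣ (true ∷ A)  (true ∷ B)  =
  cong suc (trans (cong suc (∣merge∣ A B)) (sym (+-suc ∣ A ∣ ∣ B ∣)))

unmerge : ∀ n (S : Subset (n * 2)) → ∃₂ λ A B → S ≡ merge {n} A B
unmerge zero    []          = [] , [] , refl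
unmerge (suc n) (a ∷ b ∷ S) =
  let A , B , eq = unmerge n S in a ∷ A , b ∷ B , cong (λ S → a ∷ b ∷ S) eq

side : Bool → Subset n → Subset n → Subset n
side a A B = if a then B else A

∈-merge⁻ : ∀ {A B : Subset n} {x} → x ∈ merge A B → proj₁ (half n x) ∈ side (proj₂ (half n x)) A B
∈-merge⁻ {suc n} {_ ∷ _} {_ ∷ _} {zero}        here              = here
∈-merge⁻ {suc n} {_ ∷ _} {_ ∷ _} {suc zero}    (there here)      = here
∈-merge⁻ {suc n} {_ ∷ _} {_ ∷ _} {suc (suc x)} (there (there p)) with half n x | ∈-merge⁻ {n} p
... | _ , false | q = there q
... | _ , true  | q = there q

∈-merge⁺ : ∀ {A B : Subset n} a {i} → i ∈ side a A B → twin (i , a) ∈ merge A B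
∈-merge⁺ {A = _ ∷ A} {_ ∷ B} false here      = here
∈-merge⁺ {A = _ ∷ A} {_ ∷ B} true  here      = there here
∈-merge⁺ {A = _ ∷ A} {_ ∷ B} false (there p) = there (there (∈-merge⁺ false p))
∈-merge⁺ {A = _ ∷ A} {_ ∷ B} true  (there p) = there (there (∈-merge⁺ true p))

Disjoint : Subset n → Subset n → Set
Disjoint A B = ∀ {u} → u ∈ A → u ∉ B

∣∪∣ : ∀ (A B : Subset n) → Disjoint A B → ∣ A ∪ B ∣ ≡ ∣ A ∣ + ∣ B ∣
∣∪∣ []          []          _ = refl
∣∪∣ (false ∷ A) (false ∷ B) d = ∣∪∣ A B λ p q → d (there p) (there q)
∣∪∣ (false ∷ A) (true ∷ B)  d =
  trans (cong suc (∣∪∣ A B λ p q → d (there p) (there q))) (sym (+-suc ∣ A ∣ ∣ B ∣))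
∣∪∣ (true ∷ A)  (false ∷ B) d = cong suc (∣∪∣ A B λ p q → d (there p) (there q))
∣∪∣ (true ∷ A)  (true ∷ B)  d = contradiction here (d here)

∣∩∣+∣∩∁∣ : ∀ (S C : Subset n) → ∣ S ∩ C ∣ + ∣ S ∩ ∁ C ∣ ≡ ∣ S ∣
∣∩∣+∣∩∁∣ []          []          = refl
∣∩∣+∣∩∁∣ (false ∷ S) (_ ∷ C)     = ∣∩∣+∣∩∁∣ S C
∣∩∣+∣∩∁∣ (true ∷ S)  (true ∷ C)  = cong suc (∣∩∣+∣∩∁∣ S C)
∣∩∣+∣∩∁∣ (true ∷ S)  (false ∷ C) = trans (+-suc _ _) (cong suc (∣∩∣+∣∩∁∣ S C))

shrink : ∀ (S : Subset n) k → k ≤ ∣ S ∣ → ∃ λ R → R ⊆ S × ∣ R ∣ ≡ k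
shrink []          zero    _ = [] , id , refl
shrink (false ∷ S) k       p =
  let R , R⊆S , eq = shrink S k p in false ∷ R , (λ where (there q) → there (R⊆S q)) , eq
shrink (true ∷ S)  zero    p =
  let R , R⊆S , eq = shrink S zero z≤n in false ∷ R , (λ where (there q) → there (R⊆S q)) , eq
shrink (true ∷ S)  (suc k) (s≤s p) =
  let R , R⊆S , eq = shrink S k p in
  true ∷ R , (λ where here → here ; (there q) → there (R⊆S q)) , cong suc eq

-- Bipartite subgraphs and pairs of independent sets

IndependentSet BipartiteSubgraph : Graph (Fin n) → ℕ → Set
IndependentSet    {n} G k = Σ (Subset n) λ S → k ≤ ∣ S ∣ × Independent G S
BipartiteSubgraph {n} G k = Σ (Subset n) λ S → k ≤ ∣ S ∣ × Bipartite (G ⟦ S ⟧)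

-- Disjointness makes the two sizes add up to the size of the union.
IndependentPair : Graph (Fin n) → ℕ → Set
IndependentPair G k = ∃₂ λ A B → k ≤ ∣ A ∣ + ∣ B ∣ × Independent G A × Independent G B ×
    Disjoint A B

bipartite⇒pair : ∀ (G : Graph (Fin n)) → BipartiteSubgraph G k → IndependentPair G k
bipartite⇒pair {n} G (S , k≤ , colour , proper) =
  S ∩ C , S ∩ ∁ C , ≤-trans k≤ (≤-reflexive (sym (∣∩∣+∣∩∁∣ S C))) ,
  (λ u∈ v∈ e → monochromatic (in-C u∈) (in-C v∈) e) ,
  (λ u∈ v∈ e → monochromatic (in-∁C u∈) (in-∁C v∈) e) ,
  (λ u∈ u∈′ → x∈∁p⇒x∉p (x∈p∩q⁻ S _ u∈′ .proj₂) (x∈p∩q⁻ S _ u∈ .proj₂))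
  where
  colour? : ∀ {u} → Dec (u ∈ S) → Bool
  colour? (yes p) = colour (_ , p)
  -- An arbitrary value: `C` and its complement are only used within `S`.
  colour? (no _)  = false

  C : Subset n
  C = tabulate λ u → colour? (u ∈? S)

  -- `colour` takes a membership proof, so the one that `∈?` found is returned along with the
  -- colour; `proper` accepts any proofs.
  has-colour : ∀ {u} c → u ∈ S → lookup C u ≡ c → ∃ λ p → colour (u , p) ≡ c
  has-colour {u} c u∈S eq with u ∈? S | trans (sym (lookup∘tabulate (λ u → colour? (u ∈? S)) u)) eq
  ... | yes p | eq′ = p , eq′
  ... | no u∉S | _  = contradiction u∈S u∉S

  in-C : ∀ {u} → u ∈ S ∩ C → ∃ λ p → colour (u , p) ≡ true
  in-C u∈ = has-colour true (x∈p∩q⁻ S C u∈ .proj₁) ([]=⇒lookup (x∈p∩q⁻ S C u∈ .proj₂))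

  in-∁C : ∀ {u} → u ∈ S ∩ ∁ C → ∃ λ p → colour (u , p) ≡ false
  in-∁C {u} u∈ = has-colour false (x∈p∩q⁻ S _ u∈ .proj₁)
    (¬-not λ eq → x∈∁p⇒x∉p (x∈p∩q⁻ S _ u∈ .proj₂) (lookup⇒[]= u C eq))

  monochromatic : ∀ {u v c} → (∃ λ p → colour (u , p) ≡ c) → (∃ λ q → colour (v , q) ≡ c) →
                  ¬ Adjacent G u v
  monochromatic (p , eq) (q , eq′) e = proper (_ , p) (_ , q) e (trans eq (sym eq′))

-- Membership in `A` is a proper colouring: a vertex of the union outside `A` lies in `B`, so each
-- colour class is contained in an independent set.
pair⇒bipartite : ∀ (G : Graph (Fin n)) → IndependentPair G k → BipartiteSubgraph G k
pair⇒bipartite G (A , B , k≤ , A-ind , B-ind , disjoint) =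
  A ∪ B , ≤-trans k≤ (≤-reflexive (sym (∣∪∣ A B disjoint))) , (λ (u , _) → lookup A u) , proper
  where
  in-B : ∀ {u} → u ∈ A ∪ B → lookup A u ≡ false → u ∈ B
  in-B u∈ eq with x∈p∪q⁻ A B u∈
  ... | inj₁ u∈A = contradiction (trans (sym ([]=⇒lookup u∈A)) eq) λ ()
  ... | inj₂ u∈B = u∈B

  proper : ∀ u v → Adjacent G (proj₁ u) (proj₁ v) → lookup A (proj₁ u) ≢ lookup A (proj₁ v)
  proper (u , u∈) (v , v∈) e eq with lookup A u in eqᵤ
  ... | true  = A-ind (lookup⇒[]= u A eqᵤ) (lookup⇒[]= v A (sym eq)) e
  ... | false = B-ind (in-B u∈ eqᵤ) (in-B v∈ (sym eq)) e

merged-independent : ∀ (G : Graph (Fin n)) {A B} → Independent (doubled m G) (merge A B) →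
  ∀ {i j} a b → i ∈ side a A B → j ∈ side b A B → ¬ Adjacent (prism m G) (i , a) (j , b)
merged-independent {m = m} G ind a b i∈ j∈ e =
  ind (∈-merge⁺ a i∈) (∈-merge⁺ b j∈)
    (subst₂ (Adjacent (prism m G)) (sym (half-twin _)) (sym (half-twin _)) e)

-- For either value of `m` the rung between the two copies of `u` forbids taking both.
merged-disjoint : ∀ (G : Graph (Fin n)) {A B} → Independent (doubled m G) (merge A B) → Disjoint A B
merged-disjoint {m = m} G ind u∈A u∈B =
  merged-independent G ind false true u∈A u∈B (prism-rung {m = m} G _)

pair⇒independent-product : ∀ (G : Graph (Fin n)) → IndependentPair G k →
    IndependentSet (doubled false G) k
pair⇒independent-product {n} G (A , B , k≤ , A-ind , B-ind , disjoint) =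
  merge A B , ≤-trans k≤ (≤-reflexive (sym (∣merge∣ A B))) ,
  λ {x} {y} x∈ y∈ e → independent _ _ (∈-merge⁻ x∈) (∈-merge⁻ y∈) (product-adjacent G e)
  where
  independent : ∀ {i j} a b → i ∈ side a A B → j ∈ side b A B →
                ¬ ((a ≡ b × Adjacent G i j) ⊎ (a ≢ b × i ≡ j))
  independent false _ i∈ j∈ (inj₁ (refl , e))   = A-ind i∈ j∈ e
  independent true  _ i∈ j∈ (inj₁ (refl , e))   = B-ind i∈ j∈ e
  independent false true i∈ j∈ (inj₂ (_ , refl)) = disjoint i∈ j∈
  independent true false i∈ j∈ (inj₂ (_ , refl)) = disjoint j∈ i∈
  independent false false i∈ j∈ (inj₂ (a≢a , _)) = a≢a refl
  independent true  true  i∈ j∈ (inj₂ (a≢a , _)) = a≢a refl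

independent-product⇒pair : ∀ (G : Graph (Fin n)) → IndependentSet (doubled false G) k →
    IndependentPair G k
independent-product⇒pair {n} G (S , k≤ , ind) with unmerge n S
... | A , B , refl = A , B , ≤-trans k≤ (≤-reflexive (∣merge∣ A B)) ,
  (λ u∈ v∈ e → merged-independent G ind false false u∈ v∈ e) ,
  (λ u∈ v∈ e → merged-independent G ind true true u∈ v∈ e) ,
  merged-disjoint G ind

-- Copies of adjacent vertices are adjacent whichever copies are taken, so the projection to `G` is
-- independent; the rungs make the projection injective on the set, so its size is preserved.
independent-twins⇒independent : ∀ (G : Graph (Fin n)) → IndependentSet (doubled true G) k →
    IndependentSet G k
independent-twins⇒independent {n} G (S , k≤ , ind) with unmerge n S
... | A , B , refl =
  A ∪ B , ≤-trans k≤ (≤-reflexive (trans (∣merge∣ A B) (sym (∣∪∣ A B (merged-disjoint G ind))))) ,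
      independent
  where
  which : ∀ {u} → u ∈ A ∪ B → ∃ λ a → u ∈ side a A B
  which u∈ with x∈p∪q⁻ A B u∈
  ... | inj₁ p = false , p
  ... | inj₂ p = true , p

  independent : Independent G (A ∪ B)
  independent u∈ v∈ e = let a , p = which u∈ ; b , q = which v∈ in
    merged-independent G ind a b p q (prism-twins G a b e)

pair-twins⇒independent : ∀ (G : Graph (Fin n)) → IndependentPair (doubled true G) (k + k) →
    IndependentSet G k
pair-twins⇒independent {k = k} G (X , Y , k≤ , X-ind , Y-ind , _) with ≤-total k ∣ X ∣
... | inj₁ k≤X = independent-twins⇒independent G (X , k≤X , X-ind)
... | inj₂ X≤k = independent-twins⇒independent G
  -- Here `k + k ≤ ∣ X ∣ + ∣ Y ∣ ≤ k + ∣ Y ∣`.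
  (Y , +-cancelˡ-≤ k _ _ (≤-trans k≤ (+-monoˡ-≤ ∣ Y ∣ X≤k)) , Y-ind)

-- The colour of a vertex is the copy it belongs to: an edge inside one copy is an edge of `G`
-- between members of `S`.
independent⇒bipartite-twins : ∀ (G : Graph (Fin n)) → IndependentSet G k →
                              BipartiteSubgraph (doubled true G) (k + k)
independent⇒bipartite-twins {n} G (S , k≤ , ind) =
  merge S S , ≤-trans (+-mono-≤ k≤ k≤) (≤-reflexive (sym (∣merge∣ S S))) ,
  (λ (x , _) → proj₂ (half n x)) , λ (x , x∈) (y , y∈) e eq →
      proper _ _ (∈-merge⁻ x∈) (∈-merge⁻ y∈) e eq
  where
  proper : ∀ {i j} a b → i ∈ side a S S → j ∈ side b S S →
           Adjacent (prism true G) (i , a) (j , b) → a ≢ b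
  proper false _ i∈ j∈ e refl = ind i∈ j∈ e
  proper true  _ i∈ j∈ e refl = ind i∈ j∈ e

-- Polynomial bounds and parsing of graphs

-- Times are computed in terms of `n` and `k`, but a reduction is charged by the length of its
-- input. Asking for the bound at every `L` above `n + k` lets that length be substituted
-- afterwards.
PolyBounded : (ℕ → ℕ → ℕ) → Set
PolyBounded T = ∃₂ λ c e → ∀ n k {L} → n + k ≤ L → T n k ≤ c * suc L ^ e

poly-const : ∀ c → PolyBounded λ _ _ → c
poly-const c = c , 0 , λ n k _ → ≤-reflexive (sym (*-identityʳ c))

poly-size : PolyBounded _+_
poly-size = 1 , 1 , λ n k {L} p → ≤-trans p (≤-trans (n≤1+n L)
  (≤-reflexive (sym (trans (*-identityˡ _) (^-identityʳ (suc L))))))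

poly-mono : ∀ {T U} → (∀ n k → T n k ≤ U n k) → PolyBounded U → PolyBounded T
poly-mono T≤U (c , e , b) = c , e , λ n k p → ≤-trans (T≤U n k) (b n k p)

poly-n : PolyBounded λ n _ → n
poly-n = poly-mono m≤m+n poly-size

poly-k : PolyBounded λ _ k → k
poly-k = poly-mono (λ n k → m≤n+m k n) poly-size

poly-+ : ∀ {T U} → PolyBounded T → PolyBounded U → PolyBounded λ n k → T n k + U n k
poly-+ (c , e , b) (c′ , e′ , b′) = c + c′ , e + e′ , λ n k {L} p →
  ≤-trans (+-mono-≤ (≤-trans (b n k p) (*-monoʳ-≤ c (^-monoʳ-≤ (suc L) (m≤m+n e e′))))
                    (≤-trans (b′ n k p) (*-monoʳ-≤ c′ (^-monoʳ-≤ (suc L) (m≤n+m e′ e)))))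
          (≤-reflexive (sym (*-distribʳ-+ (suc L ^ (e + e′)) c c′)))

poly-* : ∀ {T U} → PolyBounded T → PolyBounded U → PolyBounded λ n k → T n k * U n k
poly-* (c , e , b) (c′ , e′ , b′) = c * c′ , e + e′ , λ n k {L} p →
  ≤-trans (*-mono-≤ (b n k p) (b′ n k p))
          (≤-reflexive (trans ([m*n]*[o*p]≡[m*o]*[n*p] c (suc L ^ e) c′ (suc L ^ e′))
                              (cong (c * c′ *_) (sym (^-distribˡ-+-* (suc L) e e′)))))

-- The cost of a loop, in the shape in which run-loop adds it up.
repeat : ℕ → ℕ → ℕ → ℕ
repeat zero    K c = c
repeat (suc n) K c = K + repeat n K c

repeat≡ : ∀ n K c → repeat n K c ≡ n * K + c
repeat≡ zero    K c = refl
repeat≡ (suc n) K c = trans (cong (K +_) (repeat≡ n K c)) (sym (+-assoc K (n * K) c))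

poly-repeat : ∀ {F K c} → PolyBounded F → PolyBounded K → PolyBounded c →
              PolyBounded λ n k → repeat (F n k) (K n k) (c n k)
poly-repeat {F} {K} {c} pF pK pc =
    poly-mono (λ n k → ≤-reflexive (repeat≡ (F n k) (K n k) (c n k))) (poly-+ (poly-* pF pK) pc)

length-matrix : ∀ r n (H : Fin r → Fin n → Bool) →
                length (concat (List.tabulate λ i → List.tabulate (H i))) ≡ r * n
length-matrix zero    n H = refl
length-matrix (suc r) n H = trans (length-++ (List.tabulate (H zero)))
  (cong₂ _+_ (length-tabulate (H zero)) (length-matrix r n (H ∘ suc)))

length-encodeGraph : ∀ {n} (G : Graph (Fin n)) → length (encodeGraph G) ≡ n + suc (n * n)
length-encodeGraph {n} G = trans (length-++ (unary n))
  (cong₂ _+_ (length-replicate n) (cong suc (length-matrix n n (edge G))))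

start-state : ∀ x k → Agrees (x ∷ unary k ∷ [] ∷ [] ∷ [] ∷ [] ∷ [] ∷ [] ∷ [] ∷ []) (load x k)
start-state x k 0F = refl
start-state x k 1F = refl
start-state x k 2F = refl
start-state x k 3F = refl
start-state x k 4F = refl
start-state x k 5F = refl
start-state x k 6F = refl
start-state x k 7F = refl
start-state x k 8F = refl

Run⇒Computes : ∀ {P t x k v bound x′ k′} →
  Run P (x ∷ unary k ∷ [] ∷ [] ∷ [] ∷ [] ∷ [] ∷ [] ∷ [] ∷ []) t v →
  t ≤ bound → lookup v 0F ≡ x′ → lookup v 1F ≡ unary k′ → Computes P bound (x , k) (x′ , k′)
Run⇒Computes {x = x} {k} p t≤ eq eq′ =
  let t′ , s , p′ , t′≤ , ag , _ = p .execute (start-state x k)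
  in t′ , s , p′ , ≤-trans t′≤ t≤ , trans (ag 0F) eq , trans (ag 1F) eq′

run-move-≤ : ∀ {N L} (i j : Fin N) → i ≢ j → ∀ w o v → length w ≤ L →
             Run (move (toℕ i) (toℕ j)) (v Vec.[ i ]≔ w Vec.[ j ]≔ o) (1 + L * 4)
                 (v Vec.[ i ]≔ [] Vec.[ j ]≔ (w ʳ++ o))
run-move-≤ i j i≢j w o v w≤L = run-≤ (s≤s (*-monoˡ-≤ 4 w≤L)) (run-move i j i≢j w o v)

-- `h` is what one input vertex contributes to the header of the output: two vertices when a graph
-- is doubled, one input when a circuit is written.
emits : ℕ → Program
emits zero    = skip
emits (suc h) = push true 2 ⨾ emits h

-- Register 8 is nonempty until the separator after the vertices has been read.
header : ℕ → Program
header h = push true 8 ⨾ while 8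
  (branch 0 (pop 8) (pop 0 ⨾ pop 8) (pop 0 ⨾ push true 3 ⨾ push true 5 ⨾ emits h))

run-emits : ∀ h {x k o a b c d e f} → Run (emits h)
  (x ∷ k ∷ o ∷ a ∷ b ∷ c ∷ d ∷ e ∷ f ∷ []) (h + 1)
  (x ∷ k ∷ (unary h ʳ++ o) ∷ a ∷ b ∷ c ∷ d ∷ e ∷ f ∷ [])
run-emits zero    = run-skip
run-emits (suc h) = run-push 2F ⨾ʳ run-emits h

unary-+-ʳ++ : ∀ m n w → unary (m + n) ʳ++ w ≡ unary n ʳ++ (unary m ʳ++ w)
unary-+-ʳ++ zero    n w = refl
unary-+-ʳ++ (suc m) n w = unary-+-ʳ++ m n (true ∷ w)

header-time : ℕ → ℕ → ℕ
header-time h n = 1 + repeat n (6 + h) 5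

run-header : ∀ h n {x k} → Run (header h)
  ((unary n ++ false ∷ x) ∷ k ∷ [] ∷ [] ∷ [] ∷ [] ∷ [] ∷ [] ∷ [] ∷ []) (header-time h n)
  (x ∷ k ∷ (unary (n * h) ʳ++ []) ∷ unary n ∷ [] ∷ unary n ∷ [] ∷ [] ∷ [] ∷ [])
run-header h n {x} {k} = run-push 8F ⨾ʳ go n 0 [] (+-identityʳ n)
  where
  body = branch 0 (pop 8) (pop 0 ⨾ pop 8) (pop 0 ⨾ push true 3 ⨾ push true 5 ⨾ emits h)

  go : ∀ n a o {m} → n + a ≡ m → Run (while 8 body)
    ((unary n ++ false ∷ x) ∷ k ∷ o ∷ unary a ∷ [] ∷ unary a ∷ [] ∷ [] ∷ (true ∷ []) ∷ [])
    (repeat n (6 + h) 5)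
    (x ∷ k ∷ (unary (n * h) ʳ++ o) ∷ unary m ∷ [] ∷ unary m ∷ [] ∷ [] ∷ [] ∷ [])
  go zero    a o refl = run-loop 8F refl (run-false 0F refl (run-pop 0F ⨾ʳ run-pop 8F))
      (run-exit 8F refl)
  go (suc n) a o {m} eq =
    run-≤ (≤-reflexive (cong (λ t → suc (suc (3 + t)) + repeat n (6 + h) 5) (+-comm h 1)))
    (run-≡ (cong (λ w → x ∷ k ∷ w ∷ unary m ∷ [] ∷ unary m ∷ [] ∷ [] ∷ [] ∷ [])
        (sym (unary-+-ʳ++ h (n * h) o)))
    (run-loop 8F refl
      (run-true 0F refl (run-pop 0F ⨾ʳ run-push 3F ⨾ʳ run-push 5F ⨾ʳ run-emits h))
      (go n (suc a) (unary h ʳ++ o) (trans (+-suc n a) eq))))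

poly-header : ∀ h → PolyBounded λ n _ → header-time h n
poly-header h = poly-+ (poly-const 1) (poly-repeat poly-n (poly-const (6 + h)) (poly-const 5))

-- Writing down a prism

-- The entry between different copies, `cross` in `prism`, with `δ` telling whether the column is
-- that of the row's own vertex.
crossing : Bool → Bool → Bool → Bool
crossing m δ b = δ ∨ (m ∧ b)

bit : Word → ℕ → Bool
bit []      _       = false
bit (c ∷ w) zero    = c
bit (c ∷ w) (suc i) = bit w i

-- A row of the adjacency matrix, read against a word marking its diagonal entry,
-- becomes the rows of the two copies of its vertex.
row₁ row₂ : Bool → Word → Word → Word
row₁ m E []             = []
row₁ m [] (b ∷ w)       = b ∷ crossing m false b ∷ row₁ m [] w
row₁ m (δ ∷ E) (b ∷ w)  = b ∷ crossing m δ b ∷ row₁ m E w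
row₂ m E []             = []
row₂ m [] (b ∷ w)       = crossing m false b ∷ b ∷ row₂ m [] w
row₂ m (δ ∷ E) (b ∷ w)  = crossing m δ b ∷ b ∷ row₂ m E w

-- Register 2 collects the output in reverse, and 8 the second of the two rows.
-- Registers 3 and 4 count the columns ahead and behind, 5 the rows ahead; 6 and 7
-- hold the parts of the diagonal mark ahead and behind.
emit : Bool → Bool → Bool → Program
emit m δ b = pop 0 ⨾ push b 2 ⨾ push (crossing m δ b) 2 ⨾ push (crossing m δ b) 8 ⨾ push b 8

cell : Bool → Bool → Program
cell m δ = branch 0 skip (emit m δ false) (emit m δ true)

columns : Bool → Program
columns m = while 3 (pop 3 ⨾ push true 4 ⨾
  branch 6 (cell m false) (pop 6 ⨾ push false 7 ⨾ cell m false) (pop 6 ⨾ push true 7 ⨾ cell m true))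

row : Bool → Program
row m = columns m ⨾ move 4 3 ⨾ move 7 6 ⨾ move 8 7 ⨾ move 7 2 ⨾ push false 6

doubleParameter : Program
doubleParameter = while 1 (pop 1 ⨾ push true 4 ⨾ push true 4) ⨾ while 4 (pop 4 ⨾ push true 1)

double-program : Bool → Program
double-program m = header 2 ⨾ push false 2 ⨾ push true 6 ⨾ while 5 (pop 5 ⨾ row m) ⨾ move 2 0 ⨾
                   (if m then doubleParameter else skip)

run-cell : ∀ m δ b {x k o N J R E E′ B} → Run (cell m δ)
  ((b ∷ x) ∷ k ∷ o ∷ N ∷ J ∷ R ∷ E ∷ E′ ∷ B ∷ []) 6
  (x ∷ k ∷ (crossing m δ b ∷ b ∷ o) ∷ N ∷ J ∷ R ∷ E ∷ E′ ∷ (b ∷ crossing m δ b ∷ B) ∷ [])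
run-cell m δ false = run-false 0F refl
  (run-pop 0F ⨾ʳ run-push 2F ⨾ʳ run-push 2F ⨾ʳ run-push 8F ⨾ʳ run-push 8F)
run-cell m δ true  = run-true 0F refl
  (run-pop 0F ⨾ʳ run-push 2F ⨾ʳ run-push 2F ⨾ʳ run-push 8F ⨾ʳ run-push 8F)

-- Reading a row shifts the diagonal mark from register 6 to 7, and how much of it has been shifted
-- when the row ends is not tracked. The invariant `E₁′ ʳ++ E₁ ≡ E′ ʳ++ E` is all that `move 7 6`
-- needs to restore the mark; the length bound limits its time.
run-columns : ∀ m w {x k R} o J E E′ B → ∃₂ λ E₁ E₁′ →
  E₁′ ʳ++ E₁ ≡ E′ ʳ++ E × length E₁′ ≤ length w + length E′ × Run (columns m)
  ((w ++ x) ∷ k ∷ o ∷ unary (length w) ∷ J ∷ R ∷ E ∷ E′ ∷ B ∷ [])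
  (repeat (length w) 12 1)
  (x ∷ k ∷ (row₁ m E w ʳ++ o) ∷ [] ∷ (unary (length w) ʳ++ J) ∷ R ∷ E₁ ∷ E₁′ ∷
      (row₂ m E w ʳ++ B) ∷ [])
run-columns m [] o J E E′ B = E , E′ , refl , ≤-refl , run-exit 3F refl
run-columns m (b ∷ w) o J [] E′ B =
  let E₁ , E₁′ , eq , len , loop = run-columns m w
        (crossing m false b ∷ b ∷ o) (true ∷ J) [] E′ (b ∷ crossing m false b ∷ B)
  in E₁ , E₁′ , eq , ≤-trans len (n≤1+n _) ,
     -- Past the end of the mark no symbol is shifted, which saves two steps; the time is padded to
     -- that of the other cases.
     run-loop 3F refl (run-≤ {t = 9} (m≤m+n 9 2)
       (run-pop 3F ⨾ʳ run-push 4F ⨾ʳ run-empty 6F refl (run-cell m false b))) loop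
run-columns m (b ∷ w) o J (false ∷ E) E′ B =
  let E₁ , E₁′ , eq , len , loop = run-columns m w
        (crossing m false b ∷ b ∷ o) (true ∷ J) E (false ∷ E′) (b ∷ crossing m false b ∷ B)
  in E₁ , E₁′ , eq , ≤-trans len (≤-reflexive (+-suc (length w) (length E′))) ,
     run-loop 3F refl (run-pop 3F ⨾ʳ run-push 4F ⨾ʳ
       run-false 6F refl (run-pop 6F ⨾ʳ run-push 7F ⨾ʳ run-cell m false b)) loop
run-columns m (b ∷ w) o J (true ∷ E) E′ B =
  let E₁ , E₁′ , eq , len , loop = run-columns m w
        (crossing m true b ∷ b ∷ o) (true ∷ J) E (true ∷ E′) (b ∷ crossing m true b ∷ B)
  in E₁ , E₁′ , eq , ≤-trans len (≤-reflexive (+-suc (length w) (length E′))) ,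
     run-loop 3F refl (run-pop 3F ⨾ʳ run-push 4F ⨾ʳ
       run-true 6F refl (run-pop 6F ⨾ʳ run-push 7F ⨾ʳ run-cell m true b)) loop

length-row₂ : ∀ m E w → length (row₂ m E w) ≡ length w * 2
length-row₂ m E       []      = refl
length-row₂ m []      (b ∷ w) = cong (2 +_) (length-row₂ m [] w)
length-row₂ m (δ ∷ E) (b ∷ w) = cong (2 +_) (length-row₂ m E w)

row-time : ℕ → ℕ
row-time n = repeat n 12 1 + ((1 + n * 4) +
    ((1 + n * 4) + ((1 + n * 2 * 4) + ((1 + n * 2 * 4) + 1))))

-- The second row was collected in register 8 and lies there backwards. The detour through register
-- 7 reverses it once more, so it reaches the output in the same orientation as the first row. The
-- final `push false 6` advances the mark to the next diagonal entry.
run-row : ∀ m w {x k R} o E → Run (row m)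
  ((w ++ x) ∷ k ∷ o ∷ unary (length w) ∷ [] ∷ R ∷ E ∷ [] ∷ [] ∷ []) (row-time (length w))
  (x ∷ k ∷ (row₂ m E w ʳ++ (row₁ m E w ʳ++ o)) ∷ unary (length w) ∷ [] ∷ R ∷ (false ∷ E) ∷ [] ∷
      [] ∷ [])
run-row m w {x} {k} {R} o E with run-columns m w {x} {k} {R} o [] E [] []
... | E₁ , E₁′ , restored , len , columns-run =
  columns-run ⨾ʳ
  run-≡ (cong (λ N → x ∷ k ∷ o₁ ∷ N ∷ [] ∷ R ∷ E₁ ∷ E₁′ ∷ B ∷ [])
      (reverse-involutive (unary (length w))))
    (run-move-≤ 4F 3F (λ ()) (reverse (unary (length w))) []
        (x ∷ k ∷ o₁ ∷ [] ∷ [] ∷ R ∷ E₁ ∷ E₁′ ∷ B ∷ [])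
      (≤-reflexive (trans (length-reverse (unary (length w))) (length-replicate (length w))))) ⨾ʳ
  run-≡ (cong (λ E → x ∷ k ∷ o₁ ∷ unary (length w) ∷ [] ∷ R ∷ E ∷ [] ∷ B ∷ []) restored)
    (run-move-≤ 7F 6F (λ ()) E₁′ E₁ (x ∷ k ∷ o₁ ∷ unary (length w) ∷ [] ∷ R ∷ E₁ ∷ E₁′ ∷ B ∷ [])
      (≤-trans len (≤-reflexive (+-identityʳ (length w))))) ⨾ʳ
  run-≡ (cong (λ B → x ∷ k ∷ o₁ ∷ unary (length w) ∷ [] ∷ R ∷ E ∷ B ∷ [] ∷ [])
      (reverse-involutive (row₂ m E w)))
    (run-move-≤ 8F 7F (λ ()) B [] (x ∷ k ∷ o₁ ∷ unary (length w) ∷ [] ∷ R ∷ E ∷ [] ∷ B ∷ [])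
      (≤-reflexive (trans (length-reverse (row₂ m E w)) (length-row₂ m E w)))) ⨾ʳ
  run-move-≤ 7F 2F (λ ()) (row₂ m E w) o₁
      (x ∷ k ∷ o₁ ∷ unary (length w) ∷ [] ∷ R ∷ E ∷ row₂ m E w ∷ [] ∷ [])
      (≤-reflexive (length-row₂ m E w)) ⨾ʳ
  run-push 6F
  where
  o₁ = row₁ m E w ʳ++ o
  B = reverse (row₂ m E w)

diagonal : ℕ → Word
diagonal zero    = true ∷ []
diagonal (suc i) = false ∷ diagonal i

rows-of : Bool → Graph (Fin n) → Fin n → Word
rows-of m G i = let w = List.tabulate (edge G i) in
  row₁ m (diagonal (toℕ i)) w ++ row₂ m (diagonal (toℕ i)) w

-- The induction is on the `r` rows still to be read; `ψ` numbers them from row `i` on, so that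
-- `diagonal i` marks the next one.
run-rows : ∀ m (G : Graph (Fin n)) {k} r i (ψ : Fin r → Fin n) → (∀ x → toℕ (ψ x) ≡ toℕ x + i) →
    ∀ o →
  ∃ λ E → Run (while 5 (pop 5 ⨾ row m))
  (concat (List.tabulate λ x → List.tabulate (edge G (ψ x))) ∷ k ∷ o ∷ unary n ∷ [] ∷ unary r ∷
      diagonal i ∷ [] ∷ [] ∷ [])
  (repeat r (2 + row-time n) 1)
  ([] ∷ k ∷ (concat (List.tabulate λ x → rows-of m G (ψ x)) ʳ++ o) ∷ unary n ∷ [] ∷ [] ∷ E ∷ [] ∷
      [] ∷ [])
run-rows m G zero i ψ ψ≡ o = _ , run-exit 5F refl
run-rows {n} m G {k} (suc r) i ψ ψ≡ o =
  let w = List.tabulate (edge G (ψ zero))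
      rest = concat (List.tabulate λ x → List.tabulate (edge G (ψ (suc x))))
      E , loop = run-rows m G r (suc i) (ψ ∘ suc) (λ x → trans (ψ≡ (suc x)) (sym (+-suc (toℕ x) i)))
                   (rows-of m G (ψ zero) ʳ++ o)
      out = trans (cong (λ i → row₂ m (diagonal i) w ʳ++ (row₁ m (diagonal i) w ʳ++ o))
          (sym (ψ≡ zero)))
                  (sym (++-ʳ++ (row₁ m (diagonal (toℕ (ψ zero))) w)))
      first = subst (λ ℓ → Run (row m)
                ((w ++ rest) ∷ k ∷ o ∷ unary ℓ ∷ [] ∷ unary r ∷ diagonal i ∷ [] ∷ [] ∷ [])
                    (row-time ℓ)
                (rest ∷ k ∷ (row₂ m (diagonal i) w ʳ++ (row₁ m (diagonal i) w ʳ++ o)) ∷ unary ℓ ∷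
                    [] ∷
                 unary r ∷ (false ∷ diagonal i) ∷ [] ∷ [] ∷ []))
                (length-tabulate (edge G (ψ zero))) (run-row m w o (diagonal i))
  in E , run-≡ (cong (λ o → [] ∷ k ∷ o ∷ unary n ∷ [] ∷ [] ∷ E ∷ [] ∷ [] ∷ [])
       (sym (++-ʳ++ (rows-of m G (ψ zero)))))
     (run-loop 5F refl (run-pop 5F ⨾ʳ
         run-≡ (cong (λ o → rest ∷ k ∷ o ∷ unary n ∷ [] ∷ unary r ∷ (false ∷ diagonal i) ∷ [] ∷
             [] ∷ []) out) first) loop)

bit-diagonal : ∀ (i j : Fin n) → bit (diagonal (toℕ i)) (toℕ j) ≡ does (i Fin.≟ j)
bit-diagonal zero    zero    = refl
bit-diagonal zero    (suc j) = refl
bit-diagonal (suc i) zero    = refl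
bit-diagonal (suc i) (suc j) = bit-diagonal i j

row₁-tabulate : ∀ m n E (h : Fin n → Bool) → row₁ m E (List.tabulate h) ≡
  List.tabulate {n = n * 2} ((λ (j , b) →
      if b then crossing m (bit E (toℕ j)) (h j) else h j) ∘ half n)
row₁-tabulate m zero    E       h = refl
row₁-tabulate m (suc n) []      h =
    cong (λ w → h zero ∷ crossing m false (h zero) ∷ w) (row₁-tabulate m n [] (h ∘ suc))
row₁-tabulate m (suc n) (δ ∷ E) h = cong (λ w → _ ∷ _ ∷ w) (row₁-tabulate m n E (h ∘ suc))

-- The second row belongs to the copy `true`, so its crossing entries are in the columns of the copy
-- `false`: hence the negation.
row₂-tabulate : ∀ m n E (h : Fin n → Bool) → row₂ m E (List.tabulate h) ≡
  List.tabulate {n = n * 2} ((λ (j , b) →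
      if Bool.not b then crossing m (bit E (toℕ j)) (h j) else h j) ∘ half n)
row₂-tabulate m zero    E       h = refl
row₂-tabulate m (suc n) []      h =
    cong (λ w → crossing m false (h zero) ∷ h zero ∷ w) (row₂-tabulate m n [] (h ∘ suc))
row₂-tabulate m (suc n) (δ ∷ E) h = cong (λ w → _ ∷ _ ∷ w) (row₂-tabulate m n E (h ∘ suc))

concat-tabulate-half : ∀ n (h : Fin n × Bool → List A) →
  concat (List.tabulate (h ∘ half n)) ≡ concat (List.tabulate λ i → h (i , false) ++ h (i , true))
concat-tabulate-half zero    h = refl
concat-tabulate-half (suc n) h =
  trans (cong (λ w → h (zero , false) ++ h (zero , true) ++ w)
      (concat-tabulate-half n (h ∘ map₁ suc)))
        (sym (++-assoc (h (zero , false)) _ _))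

rows-of-doubled : ∀ m (G : Graph (Fin n)) →
  unary (n * 2) ++ false ∷ concat (List.tabulate (rows-of m G)) ≡ encodeGraph (doubled m G)
rows-of-doubled {n} m G = cong (λ w → unary (n * 2) ++ false ∷ w)
  (trans (cong concat (tabulate-cong λ i → cong₂ _++_
           (trans (row₁-tabulate m n (diagonal (toℕ i)) (edge G i))
                  (tabulate-cong λ x → entry i (half n x .proj₂) (half n x .proj₁)))
           (trans (row₂-tabulate m n (diagonal (toℕ i)) (edge G i))
                  (tabulate-cong λ x → entry i (Bool.not (half n x .proj₂)) (half n x .proj₁)))))
         (sym (concat-tabulate-half n λ p → List.tabulate (edge (prism m G) p ∘ half n))))
  where
  entry : ∀ i c j → (if c then crossing m (bit (diagonal (toℕ i)) (toℕ j))
      (edge G i j) else edge G i j) ≡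
                    (if c then crossing m (does (i Fin.≟ j)) (edge G i j) else edge G i j)
  entry i c j = cong (λ δ → if c then crossing m δ (edge G i j) else edge G i j) (bit-diagonal i j)

doubled-parameter : Bool → ℕ → ℕ
doubled-parameter m k = if m then k + k else k

-- One time bound serves both values of `m`; for `false` the single step of `skip` is charged the
-- cost of doubling.
run-doubleParameter : ∀ m k {x E} → ∃ λ N → Run (if m then doubleParameter else skip)
  (x ∷ unary k ∷ [] ∷ unary n ∷ [] ∷ [] ∷ E ∷ [] ∷ [] ∷ [])
  (repeat k 4 1 + repeat (k + k) 3 1)
  (x ∷ unary (doubled-parameter m k) ∷ [] ∷ N ∷ [] ∷ [] ∷ E ∷ [] ∷ [] ∷ [])
run-doubleParameter {n} false k = unary n , run-≤ (≤-trans (positive k) (m≤m+n _ _)) run-skip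
  where
  positive : ∀ k → 1 ≤ repeat k 4 1
  positive zero    = ≤-refl
  positive (suc k) = s≤s z≤n
run-doubleParameter {n} true k {x} {E} = unary n , out k 0 (+-identityʳ (k + k)) ⨾ʳ
    back (k + k) 0 (+-identityʳ (k + k))
  where
  out : ∀ a c {d} → a + a + c ≡ d → Run (while 1 (pop 1 ⨾ push true 4 ⨾ push true 4))
    (x ∷ unary a ∷ [] ∷ unary n ∷ unary c ∷ [] ∷ E ∷ [] ∷ [] ∷ []) (repeat a 4 1)
    (x ∷ [] ∷ [] ∷ unary n ∷ unary d ∷ [] ∷ E ∷ [] ∷ [] ∷ [])
  out zero    c refl = run-exit 1F refl
  out (suc a) c eq   = run-loop 1F refl (run-pop 1F ⨾ʳ run-push 4F ⨾ʳ run-push 4F)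
    (out a (2 + c) (trans (trans (+-suc (a + a) (suc c))
        (cong suc (trans (+-suc (a + a) c) (cong (_+ c) (sym (+-suc a a)))))) eq))

  back : ∀ a c {d} → a + c ≡ d → Run (while 4 (pop 4 ⨾ push true 1))
    (x ∷ unary c ∷ [] ∷ unary n ∷ unary a ∷ [] ∷ E ∷ [] ∷ [] ∷ []) (repeat a 3 1)
    (x ∷ unary d ∷ [] ∷ unary n ∷ [] ∷ [] ∷ E ∷ [] ∷ [] ∷ [])
  back zero    c refl = run-exit 4F refl
  back (suc a) c eq   = run-loop 4F refl (run-pop 4F ⨾ʳ run-push 1F)
      (back a (suc c) (trans (+-suc a c) eq))

double-time : ℕ → ℕ → ℕ
double-time n k = header-time 2 n + (1 + (1 + (repeat n (2 + row-time n) 1 +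
  ((1 + (n * 2 + suc (n * 2 * (n * 2))) * 4) + (repeat k 4 1 + repeat (k + k) 3 1)))))

poly-double : PolyBounded double-time
poly-double = poly-+ (poly-header 2) (poly-+ (poly-const 1) (poly-+ (poly-const 1)
  (poly-+ (poly-repeat poly-n (poly-+ (poly-const 2) poly-row) (poly-const 1))
  (poly-+ (poly-+ (poly-const 1) (poly-*
      (poly-+ two-n (poly-+ (poly-const 1) (poly-* two-n two-n))) (poly-const 4)))
  (poly-+ (poly-repeat poly-k (poly-const 4) (poly-const 1))
          (poly-repeat (poly-+ poly-k poly-k) (poly-const 3) (poly-const 1)))))))
  where
  two-n : PolyBounded λ n _ → n * 2
  two-n = poly-* poly-n (poly-const 2)

  poly-move : ∀ {T} → PolyBounded T → PolyBounded λ n k → 1 + T n k * 4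
  poly-move p = poly-+ (poly-const 1) (poly-* p (poly-const 4))

  poly-row : PolyBounded λ n _ → row-time n
  poly-row = poly-+ (poly-repeat poly-n (poly-const 12) (poly-const 1))
    (poly-+ (poly-move poly-n) (poly-+ (poly-move poly-n)
    (poly-+ (poly-move two-n) (poly-+ (poly-move two-n) (poly-const 1)))))

double-computes : ∀ m (G : Graph (Fin n)) k →
  Computes (double-program m) (double-time n k) (encodeGraph G , k)
           (encodeGraph (doubled m G) , doubled-parameter m k)
double-computes {n} m G k =
  let M = concat (List.tabulate λ i → List.tabulate (edge G i))
      M′ = concat (List.tabulate (rows-of m G))
      E , rows-run = run-rows m G {unary k} n 0 id (λ x → sym (+-identityʳ (toℕ x)))
          (false ∷ reverse (unary (n * 2)))
      N , k-run = run-doubleParameter {n} m k {encodeGraph (doubled m G)} {E}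
      out≡ : M′ ʳ++ (false ∷ reverse (unary (n * 2))) ≡ reverse (encodeGraph (doubled m G))
      out≡ = trans (sym (++-ʳ++ (unary (n * 2)))) (cong reverse (rows-of-doubled m G))
      rows-run′ = run-≡ (cong (λ o → [] ∷ unary k ∷ o ∷ unary n ∷ [] ∷ [] ∷ E ∷ [] ∷ [] ∷
          []) out≡) rows-run
      output-run = run-≡ (cong (λ x → x ∷ unary k ∷ [] ∷ unary n ∷ [] ∷ [] ∷ E ∷ [] ∷ [] ∷ [])
                          (reverse-involutive (encodeGraph (doubled m G))))
        (run-move-≤ 2F 0F (λ ()) (reverse (encodeGraph (doubled m G))) []
          ([] ∷ unary k ∷ [] ∷ unary n ∷ [] ∷ [] ∷ E ∷ [] ∷ [] ∷ [])
          (≤-reflexive (trans (length-reverse (encodeGraph (doubled m G)))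
              (length-encodeGraph (doubled m G)))))
  in Run⇒Computes {k′ = doubled-parameter m k}
       (run-header 2 n {M} ⨾ʳ run-push 2F ⨾ʳ run-push 6F ⨾ʳ rows-run′ ⨾ʳ output-run ⨾ʳ k-run)
       ≤-refl refl refl

-- A circuit for independent sets

-- A non-edge yields the empty `or`, which is constantly false. So the number and places of the
-- gates depend on `n` alone, and with `p` gates in between, input `i` is at distance `p + i`.
pairGate : Graph (Fin n) → ∀ p → Fin n × Fin n → Gate (p + n)
pairGate G p (i , j) = if edge G i j then and ((p ↑ʳ i) ∷ (p ↑ʳ j) ∷ []) else or []

pairNodes : Graph (Fin n) → (cs : List (Fin n × Fin n)) → Nodes n (length cs + n)
pairNodes G []       = inputs
pairNodes G (c ∷ cs) = pairNodes G cs ▹ pairGate G (length cs) c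

-- `opposite` puts the oldest gate, at the largest distance, first. The references then descend,
-- which is the order in which a counter running down prints them.
pairRefs : ∀ p n → List (Fin (p + n))
pairRefs p n = List.tabulate λ x → opposite {p} x ↑ˡ n

rowPairs : Fin n → List (Fin n × Fin n)
rowPairs i = List.tabulate λ j → i , j

-- Reversed because the head of the list is the newest gate in `pairNodes`, whereas the program
-- writes the gates in the order of the matrix.
allPairs : ∀ n → List (Fin n × Fin n)
allPairs n = reverse (concat (List.tabulate rowPairs))

conflictFree : Graph (Fin n) → Circuit n
conflictFree {n} G = circuit (pairNodes G (allPairs n) ▹ or (pairRefs _ n) ▹ not zero) zero

lookup-input : ∀ (φ : ∀ {m} → Gate m → Vec A m → A) xs (G : Graph (Fin n)) cs i →
               lookup (evaluate φ xs (pairNodes G cs)) (length cs ↑ʳ i) ≡ lookup xs i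
lookup-input φ xs G []       i = refl
lookup-input φ xs G (c ∷ cs) i = lookup-input φ xs G cs i

pairValue : Graph (Fin n) → Subset n → Fin n × Fin n → Bool
pairValue G S (i , j) = edge G i j ∧ (lookup S i ∧ lookup S j)

lookup-pair : ∀ (G : Graph (Fin n)) S cs x →
  lookup (evaluate gateValue S (pairNodes G cs)) (x ↑ˡ n) ≡ pairValue G S (List.lookup cs x)
lookup-pair G S ((i , j) ∷ cs) zero with edge G i j
... | false = refl
... | true  = cong₂ _∧_ (lookup-input gateValue S G cs i)
                (trans (∧-identityʳ _) (lookup-input gateValue S G cs j))
lookup-pair G S (c ∷ cs) (suc x) = lookup-pair G S cs x

any-tabulate-true : ∀ {p} (f : A → Bool) (g : Fin p → A) x → f (g x) ≡ true →
    any f (List.tabulate g) ≡ true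
any-tabulate-true f g zero    eq rewrite eq = refl
any-tabulate-true f g (suc x) eq =
    trans (cong (f (g zero) ∨_) (any-tabulate-true f (g ∘ suc) x eq)) (∨-zeroʳ _)

any-tabulate-false : ∀ {p} (f : A → Bool) (g : Fin p → A) → (∀ x → f (g x) ≡ false) →
    any f (List.tabulate g) ≡ false
any-tabulate-false {p = zero}  f g eq = refl
any-tabulate-false {p = suc p} f g eq rewrite eq zero = any-tabulate-false f (g ∘ suc) (eq ∘ suc)

∈-allPairs : ∀ (i j : Fin n) → (i , j) ∈ₗ allPairs n
∈-allPairs i j = reverse⁺ (∈-concat⁺′ (∈-tabulate⁺ j) (∈-tabulate⁺ {f = rowPairs} i))

value-true : ∀ (G : Graph (Fin n)) S → Independent G S → atOutput gateValue S (conflictFree G) ≡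
    true
value-true {n} G S ind = cong Bool.not
    (any-tabulate-false (lookup (evaluate gateValue S (pairNodes G (allPairs n)))) _ λ x →
  trans (lookup-pair G S (allPairs n) (opposite x))
      (no-conflict (List.lookup (allPairs n) (opposite x))))
  where
  no-conflict : ∀ c → pairValue G S c ≡ false
  no-conflict (i , j) with edge G i j in e | lookup S i in i∈ | lookup S j in j∈
  ... | false | _     | _     = refl
  ... | true  | false | _     = refl
  ... | true  | true  | false = refl
  ... | true  | true  | true  = contradiction e (ind (lookup⇒[]= i S i∈) (lookup⇒[]= j S j∈))

value-independent : ∀ (G : Graph (Fin n)) S → atOutput gateValue S (conflictFree G) ≡ true →
    Independent G S
value-independent {n} G S value {i} {j} i∈ j∈ e =
  contradiction (trans (sym value) (cong Bool.not (any-tabulate-true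
    (lookup (evaluate gateValue S (pairNodes G (allPairs n)))) (λ x → opposite x ↑ˡ n)
        (opposite x) conflict))) λ ()
  where
  -- Gate `x` tests the pair `(i , j)` and stands at place `opposite x` of `pairRefs`.
  x = index (∈-allPairs i j)

  conflict : lookup (evaluate gateValue S (pairNodes G (allPairs n)))
      (opposite (opposite x) ↑ˡ n) ≡ true
  conflict = trans (cong (λ x → lookup (evaluate gateValue S (pairNodes G (allPairs n))) (x ↑ˡ n))
      (Fin.opposite-involutive x))
    (trans (lookup-pair G S (allPairs n) x)
    (trans (cong (pairValue G S) (sym (lookup-index (∈-allPairs i j))))
           (cong₂ _∧_ e (cong₂ _∧_ ([]=⇒lookup i∈) ([]=⇒lookup j∈)))))

independent⇒satisfiable : ∀ (G : Graph (Fin n)) {k} → IndependentSet G k →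
    WeightedSatisfiable (conflictFree G) k
independent⇒satisfiable G {k} (S , k≤ , ind) =
  let R , R⊆S , eq = shrink S k k≤ in R , eq , value-true G R λ u∈ v∈ → ind (R⊆S u∈) (R⊆S v∈)

satisfiable⇒independent : ∀ (G : Graph (Fin n)) {k} → WeightedSatisfiable (conflictFree G) k →
    IndependentSet G k
satisfiable⇒independent G (S , eq , value) = S , ≤-reflexive (sym eq) , value-independent G S value

maximum-≤ : ∀ {m b} (ds : Vec ℕ m) (is : List (Fin m)) → (∀ x → lookup ds x ≤ b) →
    maximum (List.map (lookup ds) is) ≤ b
maximum-≤ ds []       p = z≤n
maximum-≤ ds (i ∷ is) p = ⊔-lub (p i) (maximum-≤ ds is p)

pairs-depth : ∀ (G : Graph (Fin n)) cs x →
    lookup (evaluate gateDepth (Vec.replicate n 0) (pairNodes G cs)) x ≤ 1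
pairs-depth {n} G [] x = ≤-trans (≤-reflexive (lookup-replicate x 0)) z≤n
pairs-depth {n} G (c ∷ cs) (suc x) = pairs-depth G cs x
pairs-depth {n} G ((i , j) ∷ cs) zero with edge G i j
... | false = s≤s z≤n
... | true rewrite lookup-input gateDepth (Vec.replicate n 0) G cs i | lookup-replicate i 0
                 | lookup-input gateDepth (Vec.replicate n 0) G cs j | lookup-replicate j 0 = ≤-refl

-- Each of these gates is a binary `and` or an empty `or`, hence small: only the final disjunction
-- may be large.
pairs-weft : ∀ (G : Graph (Fin n)) cs x →
    lookup (evaluate gateWeft (Vec.replicate n 0) (pairNodes G cs)) x ≤ 0
pairs-weft {n} G [] x = ≤-reflexive (lookup-replicate x 0)
pairs-weft {n} G (c ∷ cs) (suc x) = pairs-weft G cs x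
pairs-weft {n} G ((i , j) ∷ cs) zero with edge G i j
... | false = z≤n
... | true  rewrite lookup-input gateWeft (Vec.replicate n 0) G cs i | lookup-replicate i 0
                  | lookup-input gateWeft (Vec.replicate n 0) G cs j | lookup-replicate j 0 = ≤-refl

largeness-≤ : ∀ {m} (is : List (Fin m)) → largeness is ≤ 1
largeness-≤ []              = z≤n
largeness-≤ (_ ∷ [])        = z≤n
largeness-≤ (_ ∷ _ ∷ [])    = z≤n
largeness-≤ (_ ∷ _ ∷ _ ∷ _) = ≤-refl

conflictFree-depth : ∀ (G : Graph (Fin n)) → depth (conflictFree G) ≤ 3
conflictFree-depth {n} G = s≤s (s≤s
    (maximum-≤ (evaluate gateDepth (Vec.replicate n 0) (pairNodes G (allPairs n)))
    (pairRefs _ n) (pairs-depth G (allPairs n))))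

conflictFree-weft : ∀ (G : Graph (Fin n)) → weft (conflictFree G) ≤ 1
conflictFree-weft {n} G = +-mono-≤ (largeness-≤ (pairRefs _ n))
    (maximum-≤ (evaluate gateWeft (Vec.replicate n 0) (pairNodes G (allPairs n)))
    (pairRefs _ n) (pairs-weft G (allPairs n)))

-- Writing down the circuit

-- Printing must not consume the counter: register `r` is drained into the output and register 8 at
-- once, then refilled from 8.
print : ℕ → Program
print r = while r (pop r ⨾ push true 2 ⨾ push true 8) ⨾ while 8 (pop 8 ⨾ push true r)

print-time : ℕ → ℕ
print-time a = repeat a 4 1 + repeat a 3 1

repeat-mono : ∀ {m n} K c → m ≤ n → repeat m K c ≤ repeat n K c
repeat-mono {m} {n} K c m≤n = ≤-trans (≤-reflexive (repeat≡ m K c))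
  (≤-trans (+-monoˡ-≤ c (*-monoˡ-≤ K m≤n)) (≤-reflexive (sym (repeat≡ n K c))))

-- The state is given as a function of the three registers concerned.
run-print : ∀ (r : Fin 9) (st : Word → Word → Word → Vec Word 9) →
  (∀ {a o t} → lookup (st a o t) r ≡ a) → (∀ {a o t} → lookup (st a o t) 8F ≡ t) →
  (∀ {a o t} f → updateAt (st a o t) r f ≡ st (f a) o t) →
  (∀ {a o t} f → updateAt (st a o t) 2F f ≡ st a (f o) t) →
  (∀ {a o t} f → updateAt (st a o t) 8F f ≡ st a o (f t)) →
  ∀ {M a} → a ≤ M → ∀ {o} →
  Run (print (toℕ r)) (st (unary a) o []) (print-time M) (st (unary a) (unary a ʳ++ o) [])
run-print r st at-r at-8 set-r set-2 set-8 {a = a} a≤M {o} =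
  run-≤ (+-mono-≤ (repeat-mono 4 1 a≤M) (repeat-mono 3 1 a≤M))
        (out a 0 o (+-identityʳ a) ⨾ʳ back a 0 (+-identityʳ a))
  where
  out : ∀ a t o {m} → a + t ≡ m → Run (while (toℕ r) (pop (toℕ r) ⨾ push true 2 ⨾ push true 8))
    (st (unary a) o (unary t)) (repeat a 4 1) (st [] (unary a ʳ++ o) (unary m))
  out zero    t o refl = run-exit r at-r
  out (suc a) t o eq   = run-loop r at-r
    (run-≡ (set-r _) (run-pop r) ⨾ʳ run-≡ (set-2 _) (run-push 2F) ⨾ʳ run-≡ (set-8 _) (run-push 8F))
    (out a (suc t) (true ∷ o) (trans (+-suc a t) eq))

  back : ∀ t a {o m} → t + a ≡ m → Run (while 8 (pop 8 ⨾ push true (toℕ r)))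
    (st (unary a) o (unary t)) (repeat t 3 1) (st (unary m) o [])
  back zero    a refl = run-exit 8F at-8
  back (suc t) a eq   = run-loop 8F at-8
    (run-≡ (set-8 _) (run-pop 8F) ⨾ʳ run-≡ (set-r _) (run-push r))
        (back t (suc a) (trans (+-suc t a) eq))

-- Registers 6, 4 and 7 count the rows and columns behind and the gates written;
-- a reference to an input is its index plus the number of gates since.
printRef : ℕ → Program
printRef r = push true 2 ⨾ print 7 ⨾ print r ⨾ push false 2

printAnd printOr : Program
printAnd = push true 2 ⨾ push true 2 ⨾ push false 2 ⨾ printRef 6 ⨾ printRef 4 ⨾ push false 2
printOr  = push true 2 ⨾ push true 2 ⨾ push true 2 ⨾ push false 2

pairs-program : Program
pairs-program = while 3 (pop 3 ⨾ branch 0 skip (pop 0 ⨾ printOr) (pop 0 ⨾ printAnd) ⨾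
    push true 4 ⨾ push true 7)

row-program : Program
row-program = pairs-program ⨾ move 4 3 ⨾ push true 6

refs-program : Program
refs-program = while 7 (pop 7 ⨾ push true 2 ⨾ print 7 ⨾ push false 2)

print-circuit : Program
print-circuit = header 1 ⨾ push false 2 ⨾ while 5 (pop 5 ⨾ row-program) ⨾
  -- A gate marker and the two-bit tag of `or`, then the references and their terminator.
  push true 2 ⨾ push true 2 ⨾ push true 2 ⨾ refs-program ⨾ push false 2 ⨾
  -- A gate marker, the tag of `not` and its reference zero; then the separator and the output
  -- reference zero.
  push true 2 ⨾ push false 2 ⨾ push false 2 ⨾ push false 2 ⨾ push false 2

-- One entry of `encodeRefs` for the reference `p + i`, backwards. As `p` and `i` are printed from
-- different registers, their sum arises by concatenating unary words.
refWord : ℕ → ℕ → Word → Word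
refWord p i o = false ∷ (unary i ʳ++ (unary p ʳ++ (true ∷ o)))

printRef-time : ℕ → ℕ
printRef-time M = 1 + (print-time M + (print-time M + 1))

module _ {x k o N R : Word} {M : ℕ} where

  run-printRef-6 : ∀ {J p i} → p ≤ M → i ≤ M → Run (printRef 6)
    (x ∷ k ∷ o ∷ N ∷ J ∷ R ∷ unary i ∷ unary p ∷ [] ∷ []) (printRef-time M)
    (x ∷ k ∷ refWord p i o ∷ N ∷ J ∷ R ∷ unary i ∷ unary p ∷ [] ∷ [])
  run-printRef-6 {J} {p} {i} p≤M i≤M = run-push 2F ⨾ʳ
    run-print 7F (λ a o t → x ∷ k ∷ o ∷ N ∷ J ∷ R ∷ unary i ∷ a ∷ t ∷ [])
      refl refl (λ _ → refl) (λ _ → refl) (λ _ → refl) p≤M ⨾ʳ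
    run-print 6F (λ a o t → x ∷ k ∷ o ∷ N ∷ J ∷ R ∷ a ∷ unary p ∷ t ∷ [])
      refl refl (λ _ → refl) (λ _ → refl) (λ _ → refl) i≤M ⨾ʳ
    run-push 2F

  run-printRef-4 : ∀ {I p j} → p ≤ M → j ≤ M → Run (printRef 4)
    (x ∷ k ∷ o ∷ N ∷ unary j ∷ R ∷ I ∷ unary p ∷ [] ∷ []) (printRef-time M)
    (x ∷ k ∷ refWord p j o ∷ N ∷ unary j ∷ R ∷ I ∷ unary p ∷ [] ∷ [])
  run-printRef-4 {I} {p} {j} p≤M j≤M = run-push 2F ⨾ʳ
    run-print 7F (λ a o t → x ∷ k ∷ o ∷ N ∷ unary j ∷ R ∷ I ∷ a ∷ t ∷ [])
      refl refl (λ _ → refl) (λ _ → refl) (λ _ → refl) p≤M ⨾ʳ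
    run-print 4F (λ a o t → x ∷ k ∷ o ∷ N ∷ a ∷ R ∷ I ∷ unary p ∷ t ∷ [])
      refl refl (λ _ → refl) (λ _ → refl) (λ _ → refl) j≤M ⨾ʳ
    run-push 2F

encodeRefs-∷-ʳ++ : ∀ p (i : Fin n) is o →
  encodeRefs ((p ↑ʳ i) ∷ is) ʳ++ o ≡ encodeRefs is ʳ++ refWord p (toℕ i) o
encodeRefs-∷-ʳ++ p i is o =
  trans (++-ʳ++ (concatMap (λ i → true ∷ encodeRef i) ((p ↑ʳ i) ∷ is)))
  (trans (cong (false ∷_) (++-ʳ++ (true ∷ encodeRef (p ↑ʳ i))))
  (trans (sym (++-ʳ++ (concatMap (λ i → true ∷ encodeRef i) is)))
  (cong (encodeRefs is ʳ++_) (trans (++-ʳ++ (unary (toℕ (p ↑ʳ i))))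
  (cong (false ∷_) (trans (cong (λ m → unary m ʳ++ (true ∷ o)) (Fin.toℕ-↑ʳ p i))
      (unary-+-ʳ++ p (toℕ i) (true ∷ o))))))))

entry-time : ℕ → ℕ
entry-time M = 1 + ((2 + (1 + (1 + (1 + (printRef-time M + (printRef-time M + 1)))))) + 2)

gates : Graph (Fin n) → List (Fin n × Fin n) → Word → Word
gates G cs o = encodeGates (pairNodes G cs) ʳ++ o

run-entry : ∀ (G : Graph (Fin n)) (i j : Fin n) cs {M} o → length cs ≤ M → n ≤ M → ∀ {x k r R} →
  Run (pop 3 ⨾ branch 0 skip (pop 0 ⨾ printOr) (pop 0 ⨾ printAnd) ⨾ push true 4 ⨾ push true 7)
  ((edge G i j ∷ x) ∷ k ∷ gates G cs o ∷ (true ∷ r) ∷ unary (toℕ j) ∷ R ∷ unary (toℕ i) ∷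
      unary (length cs) ∷ [] ∷ [])
  (entry-time M)
  (x ∷ k ∷ gates G ((i , j) ∷ cs) o ∷ r ∷ unary (suc (toℕ j)) ∷ R ∷ unary (toℕ i) ∷
      unary (suc (length cs)) ∷ [] ∷ [])
run-entry {n} G i j cs {M} o cs≤M n≤M {x} {k} {r} {R} = run-≡
  (cong (λ o → x ∷ k ∷ o ∷ r ∷ unary (suc (toℕ j)) ∷ R ∷ unary (toℕ i) ∷ unary (suc (length cs)) ∷
      [] ∷ [])
        (sym (++-ʳ++ (encodeGates (pairNodes G cs)))))
  entry-run
  where
  entry-run : Run (pop 3 ⨾ branch 0 skip (pop 0 ⨾ printOr) (pop 0 ⨾ printAnd) ⨾ push true 4 ⨾
      push true 7)
    ((edge G i j ∷ x) ∷ k ∷ gates G cs o ∷ (true ∷ r) ∷ unary (toℕ j) ∷ R ∷ unary (toℕ i) ∷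
        unary (length cs) ∷ [] ∷ [])
    (entry-time M)
    (x ∷ k ∷ ((true ∷ encodeGate (pairGate G (length cs) (i , j))) ʳ++ gates G cs o) ∷ r ∷
                         unary (suc (toℕ j)) ∷ R ∷ unary (toℕ i) ∷ unary (suc (length cs)) ∷ [] ∷
                             [])
  entry-run with edge G i j
  -- A non-edge costs less than an edge; its time is padded.
  ... | false = run-pop 3F ⨾ʳ run-≤
      (+-monoʳ-≤ 5 {1} {printRef-time M + (printRef-time M + 1)} (s≤s z≤n))
      (run-false 0F refl (run-pop 0F ⨾ʳ run-push 2F ⨾ʳ run-push 2F ⨾ʳ run-push 2F ⨾ʳ
          run-push 2F)) ⨾ʳ
      run-push 4F ⨾ʳ run-push 7F
  ... | true = run-pop 3F ⨾ʳ
      run-≡ (cong (λ o → x ∷ k ∷ o ∷ r ∷ unary (toℕ j) ∷ R ∷ unary (toℕ i) ∷ unary (length cs) ∷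
          [] ∷ [])
             (sym (trans (encodeRefs-∷-ʳ++ (length cs) i ((length cs ↑ʳ j) ∷ [])
                 (false ∷ true ∷ true ∷ gates G cs o))
                         (encodeRefs-∷-ʳ++ (length cs) j [] _))))
        (run-true 0F refl (run-pop 0F ⨾ʳ run-push 2F ⨾ʳ run-push 2F ⨾ʳ run-push 2F ⨾ʳ
          run-printRef-6 cs≤M (≤-trans (<⇒≤ (Fin.toℕ<n i)) n≤M) ⨾ʳ
          run-printRef-4 cs≤M (≤-trans (<⇒≤ (Fin.toℕ<n j)) n≤M) ⨾ʳ run-push 2F)) ⨾ʳ
      run-push 4F ⨾ʳ run-push 7F

-- `M` bounds every number that gets printed, so all entries are charged the same. `cs` lists the
-- gates written so far, newest first; its length, held in register 7, is the offset of the inputs.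
run-pairs : ∀ (G : Graph (Fin n)) (i : Fin n) {M} → n ≤ M → ∀ r (φ : Fin r → Fin n) j →
  (∀ y → toℕ (φ y) ≡ toℕ y + j) → ∀ {d} → r + j ≡ d → ∀ cs → length cs + r ≤ M → ∀ o {x k R} →
  let cs′ = List.tabulate (λ y → i , φ y) ʳ++ cs in Run pairs-program
  ((List.tabulate (λ y → edge G i (φ y)) ++ x) ∷ k ∷ gates G cs o ∷ unary r ∷ unary j ∷ R ∷
      unary (toℕ i) ∷ unary (length cs) ∷ [] ∷ [])
  (repeat r (1 + entry-time M) 1)
  (x ∷ k ∷ gates G cs′ o ∷ [] ∷ unary d ∷ R ∷ unary (toℕ i) ∷ unary (length cs′) ∷ [] ∷ [])
run-pairs G i n≤M zero    φ j φ≡ refl cs cs≤M o = run-exit 3F refl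
run-pairs G i {M} n≤M (suc r) φ j φ≡ eq cs cs≤M o {x} {k} {R} = run-loop 3F refl
  (subst (λ j → Run (pop 3 ⨾ branch 0 skip (pop 0 ⨾ printOr) (pop 0 ⨾ printAnd) ⨾ push true 4 ⨾
      push true 7)
    ((edge G i (φ zero) ∷ _) ∷ k ∷ gates G cs o ∷ unary (suc r) ∷ unary j ∷ R ∷ unary (toℕ i) ∷
        unary (length cs) ∷ [] ∷ [])
    (entry-time M)
    (_ ∷ k ∷ gates G ((i , φ zero) ∷ cs) o ∷ unary r ∷ unary (suc j) ∷ R ∷ unary (toℕ i) ∷
        unary (suc (length cs)) ∷ [] ∷ []))
    (φ≡ zero) (run-entry G i (φ zero) cs o (≤-trans (m≤m+n _ _) cs≤M) n≤M))
  (run-pairs G i n≤M r (φ ∘ suc) (suc j) (λ y → trans (φ≡ (suc y)) (sym (+-suc (toℕ y) j)))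
    (trans (+-suc r j) eq) ((i , φ zero) ∷ cs)
        (≤-trans (≤-reflexive (sym (+-suc (length cs) r))) cs≤M) o)

circuit-row-time : ℕ → ℕ → ℕ
circuit-row-time n M = repeat n (1 + entry-time M) 1 + ((1 + n * 4) + 1)

reverse-unary : ∀ n → reverse (unary n) ≡ unary n
reverse-unary n = trans (unary-ʳ++ n 0) (cong unary (+-identityʳ n))

run-circuit-row : ∀ (G : Graph (Fin n)) (i : Fin n) {M} → n ≤ M → ∀ cs → length cs + n ≤ M →
    ∀ o {x k R} →
  let cs′ = rowPairs i ʳ++ cs in Run row-program
  ((List.tabulate (edge G i) ++ x) ∷ k ∷ gates G cs o ∷ unary n ∷ [] ∷ R ∷ unary (toℕ i) ∷
      unary (length cs) ∷ [] ∷ [])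
  (circuit-row-time n M)
  (x ∷ k ∷ gates G cs′ o ∷ unary n ∷ [] ∷ R ∷ unary (suc (toℕ i)) ∷ unary (length cs′) ∷ [] ∷ [])
run-circuit-row {n} G i n≤M cs cs≤M o {x} {k} {R} =
  run-pairs G i n≤M n id 0 (λ y → sym (+-identityʳ (toℕ y))) (+-identityʳ n) cs cs≤M o ⨾ʳ
  run-≡ (cong (λ N → x ∷ k ∷ gates G cs′ o ∷ N ∷ [] ∷ R ∷ unary (toℕ i) ∷ unary (length cs′) ∷
      [] ∷ []) (reverse-unary n))
    (run-move-≤ 4F 3F (λ ()) (unary n) []
      (x ∷ k ∷ gates G cs′ o ∷ [] ∷ [] ∷ R ∷ unary (toℕ i) ∷ unary (length cs′) ∷ [] ∷ [])
      (≤-reflexive (length-replicate n))) ⨾ʳ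
  run-push 6F
  where
  cs′ = rowPairs i ʳ++ cs

run-circuit-rows : ∀ (G : Graph (Fin n)) {M} → n ≤ M → ∀ r (ψ : Fin r → Fin n) i →
  (∀ y → toℕ (ψ y) ≡ toℕ y + i) → ∀ cs → length cs + r * n ≤ M → ∀ o {k} →
  let cs′ = concat (List.tabulate (λ y → rowPairs (ψ y))) ʳ++ cs in ∃ λ I → Run (while 5 (pop 5 ⨾ row-program))
  (concat (List.tabulate λ y → List.tabulate (edge G (ψ y))) ∷ k ∷ gates G cs o ∷ unary n ∷ [] ∷
      unary r ∷ unary i ∷ unary (length cs) ∷ [] ∷ [])
  (repeat r (2 + circuit-row-time n M) 1)
  ([] ∷ k ∷ gates G cs′ o ∷ unary n ∷ [] ∷ [] ∷ I ∷ unary (length cs′) ∷ [] ∷ [])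
run-circuit-rows G n≤M zero ψ i ψ≡ cs cs≤M o = _ , run-exit 5F refl
run-circuit-rows {n} G {M} n≤M (suc r) ψ i ψ≡ cs cs≤M o {k} =
  let rest = concat (List.tabulate λ y → List.tabulate (edge G (ψ (suc y))))
      cs₁ = rowPairs (ψ zero) ʳ++ cs
      I , loop = run-circuit-rows G n≤M r (ψ ∘ suc) (suc i)
        (λ y → trans (ψ≡ (suc y)) (sym (+-suc (toℕ y) i))) cs₁
        (≤-trans (≤-reflexive (trans (cong (_+ r * n) (length-row cs))
            (+-assoc (length cs) n (r * n)))) cs≤M) o
      first = subst (λ i → Run row-program
        ((List.tabulate (edge G (ψ zero)) ++ rest) ∷ k ∷ gates G cs o ∷ unary n ∷ [] ∷ unary r ∷
            unary i ∷ unary (length cs) ∷ [] ∷ [])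
        (circuit-row-time n M)
        (rest ∷ k ∷ gates G cs₁ o ∷ unary n ∷ [] ∷ unary r ∷ unary (suc i) ∷ unary (length cs₁) ∷
            [] ∷ []))
        (ψ≡ zero) (run-circuit-row G (ψ zero) n≤M cs
          (≤-trans (+-monoʳ-≤ (length cs) (m≤m+n n (r * n))) cs≤M) o)
  in I , run-≡ (cong (λ cs′ → [] ∷ k ∷ gates G cs′ o ∷ unary n ∷ [] ∷ [] ∷ I ∷
       unary (length cs′) ∷ [] ∷ [])
                     (sym (++-ʳ++ (rowPairs (ψ zero)))))
       (run-loop 5F refl (run-pop 5F ⨾ʳ first) loop)
  where
  length-row : ∀ cs → length (rowPairs (ψ zero) ʳ++ cs) ≡ length cs + n
  length-row cs = trans (length-ʳ++ (rowPairs (ψ zero)))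
    (trans (cong (_+ length cs) (length-tabulate {n = n} (λ j → ψ zero , j)))
        (+-comm n (length cs)))

refsBody : ℕ → Word
refsBody zero    = []
refsBody (suc p) = true ∷ unary p ++ false ∷ refsBody p

encodeRefs-descending : ∀ p {m} (g : Fin p → Fin m) → (∀ x → toℕ (g x) ≡ toℕ (opposite x)) →
  concatMap (λ i → true ∷ encodeRef i) (List.tabulate g) ≡ refsBody p
encodeRefs-descending zero    g eq = refl
encodeRefs-descending (suc p) g eq = cong (true ∷_)
  (trans (cong₂ _++_ (cong (λ m → unary m ++ false ∷ []) (trans (eq zero) (Fin.toℕ-fromℕ p)))
                     (encodeRefs-descending p (g ∘ suc) λ x →
                         trans (eq (suc x)) (Fin.toℕ-inject₁ (opposite x))))
         (++-assoc (unary p) (false ∷ []) (refsBody p)))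

encodeRefs-pairRefs : ∀ p n → encodeRefs (pairRefs p n) ≡ refsBody p ++ false ∷ []
encodeRefs-pairRefs p n = cong (_++ false ∷ [])
  (encodeRefs-descending p (λ x → opposite x ↑ˡ n) λ x → Fin.toℕ-↑ˡ (opposite x) n)

run-refs : ∀ p {M} → p ≤ M → ∀ {x k N J R I} o → Run refs-program
  (x ∷ k ∷ o ∷ N ∷ J ∷ R ∷ I ∷ unary p ∷ [] ∷ []) (repeat p (4 + print-time M) 1)
  (x ∷ k ∷ (refsBody p ʳ++ o) ∷ N ∷ J ∷ R ∷ I ∷ [] ∷ [] ∷ [])
run-refs zero    p≤M o = run-exit 7F refl
run-refs (suc p) {M} p≤M {x} {k} {N} {J} {R} {I} o =
  run-≤ (≤-reflexive (cong (λ t → 3 + t + repeat p (4 + print-time M) 1) (+-comm (print-time M) 1)))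
  (run-≡ (cong (λ o → x ∷ k ∷ o ∷ N ∷ J ∷ R ∷ I ∷ [] ∷ [] ∷ []) (sym (++-ʳ++ (unary p))))
  (run-loop 7F refl
    (run-pop 7F ⨾ʳ run-push 2F ⨾ʳ
     run-print 7F (λ a o t → x ∷ k ∷ o ∷ N ∷ J ∷ R ∷ I ∷ a ∷ t ∷ [])
       refl refl (λ _ → refl) (λ _ → refl) (λ _ → refl) (≤-trans (n≤1+n p) p≤M) ⨾ʳ
     run-push 2F)
    (run-refs p (≤-trans (n≤1+n p) p≤M) (false ∷ (unary p ʳ++ (true ∷ o))))))

toStore : ∀ {N} → Vec Word N → Store
toStore []      r       = []
toStore (w ∷ v) zero    = w
toStore (w ∷ v) (suc r) = toStore v r

toStore-agrees : ∀ {N} (v : Vec Word N) → Agrees v (toStore v)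
toStore-agrees (w ∷ v) zero    = refl
toStore-agrees (w ∷ v) (suc i) = toStore-agrees v i

-- Bounds the circuit code, before it is turned round, by the time spent on printing it, which
-- spares a computation of its length.
run-growth : ∀ {N P t} {v v′ : Vec Word N} → Run P v t v′ → ∀ i →
    length (lookup v′ i) ≤ length (lookup v i) + t
run-growth {v = v} p i =
  let t′ , s′ , p′ , t′≤ , ag , _ = p .execute {toStore v} (toStore-agrees v)
  in ≤-trans (≤-reflexive (cong length (sym (ag i))))
     (≤-trans (length-growth p′ (toℕ i))
     (+-mono-≤ (≤-reflexive (cong length (toStore-agrees v i))) t′≤))

reverse-encodeCircuit : ∀ (G : Graph (Fin n)) → reverse (encodeCircuit (conflictFree G)) ≡
  false ∷ false ∷ false ∷ false ∷ true ∷ false ∷ (refsBody (length (allPairs n)) ʳ++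
    (true ∷ true ∷ true ∷ gates G (allPairs n) (false ∷ reverse (unary n))))
reverse-encodeCircuit {n} G =
  trans (++-ʳ++ (unary n))
  (trans (++-ʳ++ (encodeGates (pairNodes G (allPairs n) ▹ or (pairRefs _ n) ▹ not zero)))
  (cong (λ w → false ∷ false ∷ w)
  (trans (++-ʳ++ (encodeGates (pairNodes G (allPairs n) ▹ or (pairRefs _ n))))
  (cong (λ w → false ∷ false ∷ true ∷ w)
  (trans (++-ʳ++ (encodeGates (pairNodes G (allPairs n))))
  (trans (cong (_ʳ++ (true ∷ true ∷ true ∷ gates G (allPairs n) (false ∷ reverse (unary n))))
      (encodeRefs-pairRefs (length (allPairs n)) n))
         (++-ʳ++ (refsBody (length (allPairs n))))))))))

print-circuit-time : ℕ → ℕ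
-- There are `n * n` pair gates and `n` inputs; `M` is at least every gate count and every index.
print-circuit-time n = let M = n * n + n in
  header-time 1 n + (1 + (repeat n (2 + circuit-row-time n M) 1 +
  (3 + (repeat (n * n) (4 + print-time M) 1 + 6))))

circuit-program : Program
circuit-program = print-circuit ⨾ move 2 0

circuit-time : ℕ → ℕ
circuit-time n = print-circuit-time n + (1 + print-circuit-time n * 4)

length-allPairs : ∀ n → length (allPairs n) ≡ n * n
length-allPairs n = trans (length-reverse (concat (List.tabulate (rowPairs {n}))))
    (length-rows n id)
  where
  length-rows : ∀ r (ψ : Fin r → Fin n) → length (concat (List.tabulate λ y → rowPairs (ψ y))) ≡
      r * n
  length-rows zero    ψ = refl
  length-rows (suc r) ψ = trans (length-++ (rowPairs (ψ zero)))
    (cong₂ _+_ (length-tabulate {n = n} (λ j → ψ zero , j)) (length-rows r (ψ ∘ suc)))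

circuit-computes : ∀ (G : Graph (Fin n)) k →
  Computes circuit-program (circuit-time n) (encodeGraph G , k) (encodeCircuit (conflictFree G) , k)
circuit-computes {n} G k =
  let M = n * n + n
      C = encodeCircuit (conflictFree G)
      o = false ∷ reverse (unary n)
      I , rows-run = run-circuit-rows G {M} (m≤n+m n (n * n)) n id 0
          (λ y → sym (+-identityʳ (toℕ y)))
                       [] (m≤m+n (n * n) n) o {unary k}
      matrix = concat (List.tabulate λ i → List.tabulate (edge G i))
      header-run = run-≡ (cong (λ m → matrix ∷ unary k ∷ reverse (unary m) ∷ unary n ∷ [] ∷
          unary n ∷ [] ∷ [] ∷ [] ∷ []) (*-identityʳ n))
                         (run-header 1 n {matrix} {unary k})
      refs-run = run-≤ (repeat-mono (4 + print-time M) 1 (≤-reflexive (length-allPairs n)))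
        (run-refs (length (allPairs n)) {M}
            (≤-trans (≤-reflexive (length-allPairs n)) (m≤m+n (n * n) n))
          {[]} {unary k} {unary n} {[]} {[]} {I} (true ∷ true ∷ true ∷ gates G (allPairs n) o))
      print-run = run-≡ (cong (λ o → [] ∷ unary k ∷ o ∷ unary n ∷ [] ∷ [] ∷ I ∷ [] ∷ [] ∷ [])
          (sym (reverse-encodeCircuit G)))
        (header-run ⨾ʳ run-push 2F ⨾ʳ rows-run ⨾ʳ
         run-push 2F ⨾ʳ run-push 2F ⨾ʳ run-push 2F ⨾ʳ refs-run ⨾ʳ run-push 2F ⨾ʳ
         run-push 2F ⨾ʳ run-push 2F ⨾ʳ run-push 2F ⨾ʳ run-push 2F ⨾ʳ run-push 2F)
  in Run⇒Computes
       (print-run ⨾ʳ run-move-≤ 2F 0F (λ ()) (reverse C) []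
           ([] ∷ unary k ∷ [] ∷ unary n ∷ [] ∷ [] ∷ I ∷ [] ∷ [] ∷ [])
         (run-growth print-run 2F))
       ≤-refl (reverse-involutive C) refl

poly-circuit : PolyBounded λ n _ → circuit-time n
poly-circuit = poly-+ poly-build (poly-+ (poly-const 1) (poly-* poly-build (poly-const 4)))
  where
  poly-M : PolyBounded λ n _ → n * n + n
  poly-M = poly-+ (poly-* poly-n poly-n) poly-n

  poly-print : PolyBounded λ n _ → print-time (n * n + n)
  poly-print = poly-+ (poly-repeat poly-M (poly-const 4) (poly-const 1))
      (poly-repeat poly-M (poly-const 3) (poly-const 1))

  poly-printRef : PolyBounded λ n _ → printRef-time (n * n + n)
  poly-printRef = poly-+ (poly-const 1) (poly-+ poly-print (poly-+ poly-print (poly-const 1)))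

  poly-entry : PolyBounded λ n _ → entry-time (n * n + n)
  poly-entry = poly-+ (poly-const 1)
      (poly-+ (poly-+ (poly-const 5) (poly-+ poly-printRef (poly-+ poly-printRef (poly-const 1))))
          (poly-const 2))

  poly-row : PolyBounded λ n _ → circuit-row-time n (n * n + n)
  poly-row = poly-+ (poly-repeat poly-n (poly-+ (poly-const 1) poly-entry) (poly-const 1))
    (poly-+ (poly-+ (poly-const 1) (poly-* poly-n (poly-const 4))) (poly-const 1))

  poly-build : PolyBounded λ n _ → print-circuit-time n
  poly-build = poly-+ (poly-header 1) (poly-+ (poly-const 1)
    (poly-+ (poly-repeat poly-n (poly-+ (poly-const 2) poly-row) (poly-const 1))
    (poly-+ (poly-const 3) (poly-+ (poly-repeat (poly-* poly-n poly-n)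
        (poly-+ (poly-const 4) poly-print) (poly-const 1)) (poly-const 6)))))

-- The reductions

prism-twins-edge : ∀ (G : Graph (Fin n)) {i j} a b → i ≢ j → edge (prism true G) (i , a) (j , b) ≡
    edge G i j
prism-twins-edge G         false false i≢j = refl
prism-twins-edge G         true  true  i≢j = refl
prism-twins-edge G {i} {j} false true  i≢j = cong (_∨ edge G i j) (dec-false (i Fin.≟ j) i≢j)
prism-twins-edge G {i} {j} true  false i≢j = cong (_∨ edge G i j) (dec-false (i Fin.≟ j) i≢j)

prism-copies : ∀ (G : Graph (Fin n)) i {a b} → a ≢ b → Adjacent (prism true G) (i , a) (i , b)
prism-copies G i {false} {false} a≢b = contradiction refl a≢b
prism-copies G i {true}  {true}  a≢b = contradiction refl a≢b
prism-copies G i {false} {true}  a≢b = prism-rung {m = true} G i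
prism-copies G i {true}  {false} a≢b = prism-rung {m = true} G i

doubled-intersection : ∀ {𝒦 : Pred GeometricObject ℓ} (G : Graph (Fin n)) →
                       IntersectionGraphOf 𝒦 G → IntersectionGraphOf 𝒦 (doubled true G)
doubled-intersection {n = n} G (O , O∈𝒦 , O-graph) =
  O ∘ proj₁ ∘ half n , O∈𝒦 ∘ proj₁ ∘ half n , λ x y x≢y → intersects _ _ (half-≢ x≢y) (_ Fin.≟ _)
  where
  half-≢ : ∀ {x y} → x ≢ y → half n x ≢ half n y
  half-≢ x≢y eq = x≢y (trans (sym (twin-half n _)) (trans (cong twin eq) (twin-half n _)))

  intersects : ∀ {i j} a b → (i , a) ≢ (j , b) → Dec (i ≡ j) →
               Adjacent (prism true G) (i , a) (j , b) ⇔ (region (O i) ≬ region (O j))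
  -- Distinct vertices over the same `i` are its two copies: adjacent in the prism, and their common
  -- region meets itself because it is inhabited.
  intersects {i} a b p≢q (yes refl) = mk⇔
    (λ _ → let z , z∈ = GeometricObject.nonempty (O i) in z , z∈ , z∈)
    (λ _ → prism-copies G i λ a≡b → p≢q (cong (i ,_) a≡b))
  intersects {i} {j} a b p≢q (no i≢j) = mk⇔
    (λ e → Equivalence.to (O-graph i j i≢j) (trans (sym (prism-twins-edge G a b i≢j)) e))
    (λ z → trans (prism-twins-edge G a b i≢j) (Equivalence.from (O-graph i j i≢j) z))

-- Without any promise of a geometric representation, so that it accepts the product graphs.
IndependentSetProblem : Problem 0ℓ
IndependentSetProblem = record
  { Yes = λ x k → ∃ λ n → Σ (Graph (Fin n)) λ G → x ≡ encodeGraph G × IndependentSet G k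
  ; No  = λ x k → ∃ λ n → Σ (Graph (Fin n)) λ G → x ≡ encodeGraph G × ¬ IndependentSet G k
  }

-- The code of `G` begins with `n` in unary, so `n` is at most its length.
bound-by-length : ∀ {P T k out} ((c , e , _) : PolyBounded T) (G : Graph (Fin n)) →
  Computes P (T n k) (encodeGraph G , k) out →
  Computes P (c * suc (length (encodeGraph G) + k) ^ e) (encodeGraph G , k) out
bound-by-length {n} {k = k} (_ , _ , bound) G (t , s , p , t≤ , outs) =
  t , s , p , ≤-trans t≤ (bound n k (+-monoˡ-≤ k
    (≤-trans (m≤m+n n _) (≤-reflexive (sym (length-encodeGraph G)))))) , outs

product-reduction : (𝒦 : Pred GeometricObject ℓ) →
    MaximumBipartiteSubgraph 𝒦 ≤poly IndependentSetProblem
product-reduction 𝒦 = record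
  { program = double-program false
  ; scale   = poly-double .proj₁
  ; degree  = poly-double .proj₂ .proj₁
  ; factor  = 1
  ; yes↦yes = λ where
      _ k (_ , G , refl , _ , found) → _ , k ,
          bound-by-length poly-double G (double-computes false G k) ,
        ≤-reflexive (sym (*-identityˡ k)) , _ , doubled false G , refl ,
        pair⇒independent-product G (bipartite⇒pair G found)
  ; no↦no   = λ where
      _ k (_ , G , refl , _ , none) → _ , k ,
          bound-by-length poly-double G (double-computes false G k) ,
        ≤-reflexive (sym (*-identityˡ k)) , _ , doubled false G , refl ,
        λ found → none (pair⇒bipartite G (independent-product⇒pair G found))
  }

twins-reduction : (𝒦 : Pred GeometricObject ℓ) →
    MaximumIndependentSet 𝒦 ≤poly MaximumBipartiteSubgraph 𝒦
twins-reduction 𝒦 = record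
  { program = double-program true
  ; scale   = poly-double .proj₁
  ; degree  = poly-double .proj₂ .proj₁
  ; factor  = 2
  ; yes↦yes = λ where
      _ k (_ , G , refl , objects , found) → _ , k + k ,
          bound-by-length poly-double G (double-computes true G k) ,
        k+k≤2*k k , _ , doubled true G , refl , doubled-intersection {𝒦 = 𝒦} G objects ,
            independent⇒bipartite-twins G found
  ; no↦no   = λ where
      _ k (_ , G , refl , objects , none) → _ , k + k ,
          bound-by-length poly-double G (double-computes true G k) ,
        k+k≤2*k k , _ , doubled true G , refl , doubled-intersection {𝒦 = 𝒦} G objects ,
        λ found → none (pair-twins⇒independent G (bipartite⇒pair (doubled true G) found))
  }
  where
  k+k≤2*k : ∀ k → k + k ≤ 2 * k
  k+k≤2*k k = ≤-reflexive (cong (k +_) (sym (+-identityʳ k)))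

circuit-reduction : IndependentSetProblem ≤poly WeightedCircuitSat 1 3
circuit-reduction = record
  { program = circuit-program
  ; scale   = poly-circuit .proj₁
  ; degree  = poly-circuit .proj₂ .proj₁
  ; factor  = 1
  ; yes↦yes = λ where
      _ k (_ , G , refl , found) → _ , k , bound-by-length poly-circuit G (circuit-computes G k) ,
        ≤-reflexive (sym (*-identityˡ k)) , _ , conflictFree G , refl , conflictFree-weft G ,
            conflictFree-depth G ,
        independent⇒satisfiable G found
  ; no↦no   = λ where
      _ k (_ , G , refl , none) → _ , k , bound-by-length poly-circuit G (circuit-computes G k) ,
        ≤-reflexive (sym (*-identityˡ k)) , _ , conflictFree G , refl , conflictFree-weft G ,
            conflictFree-depth G ,
        λ found → none (satisfiable⇒independent G found)
  }

corollary8 : ∀ {ℓ} (𝒦 : Pred GeometricObject ℓ) →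
    W[ 1 ]-Complete (MaximumIndependentSet 𝒦) →
    W[ 1 ]-Complete (MaximumBipartiteSubgraph 𝒦)
corollary8 𝒦 (_ , hard) =
  -- The witness `3` is the depth bound of `conflictFree`; starting from `≤fpt-refl` makes the chain
  -- of two `_≤poly_` reductions an fpt reduction.
  (3 , ≤fpt-≤poly-trans (≤fpt-≤poly-trans ≤fpt-refl (product-reduction 𝒦)) circuit-reduction) ,
  λ B B∈W → ≤fpt-≤poly-trans (hard B B∈W) (twins-reduction 𝒦)
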